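{- Let $I$ be a set of problem instances with a size function $\mathrm{size}:I\to[0,\infty)$, let $n\ge1$ be an integer and $d\ge 0$. For each $z\in I$ let $h_1(z),\dots,h_n(z)$ be jointly distributed, discrete $I$-valued random variables with $0\le \mathrm{size}(h_i(z))\le\mathrm{size}(z)$, and let $S(z)$ be a real random variable. Let $a:[0,\infty)\to[0,\infty)$ be a function such that $a(x)=0$ for $x\in[0,d]$, and $a$ is positive, monotone (non-decreasing) and continuous on $(d,\infty)$. Suppose that for all $z$ with $\mathrm{size}(z)>d$ and all $r\in\mathbb{R}$, $$\Pr[S(z)>r]\le\sum_{y_1,\dots,y_n}\Pr\left[(h_1(z),\dots,h_n(z))=(y_1,\dots,y_n)\right]\cdot\Pr\left[\max_{i=1}^n S(y_i)>r-a(\mathrm{size}(z))\right].$$ Assume that for all $z$ there exists $k$ such that for all $i_1,\dots,i_k\in\{1,\dots,n\}$ we have $\Pr\left[\mathrm{size}(h_{i_1}(\cdots(h_{i_k}(z))))>d\right]=0$. Let $m:[0,\infty)\to[0,\infty)$ satisfy $0\le m(x)\le x$, with $m(x)/x$ non-decreasing on $(0,\infty)$, and suppose $E\left[\max_{i=1}^n\mathrm{size}(h_i(z))\right]\le m(\mathrm{size}(z))$ for all $z$. Let $u:\mathbb{R}\to\mathbb{R}$ be a monotone (non-decreasing) function, continuous on $(d,\infty)$, with $u(x)\ge a(x)+u(m(x))$ for all $x\ge 0$, such that $u(x)=u(d)$ for all $x\le d$, and such that $S(z)\le u(\mathrm{size}(z))$ almost surely whenever $\mathrm{size}(z)\le d$.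 Let $u':\mathbb{R}\to[0,\infty)$ be an inverse of $u$ above $d$, that is, $u'(u(x))=x$ for $x>d$ and $u(u'(y))=y$ for $y>u(d)$. Let $g_1:\mathbb{R}\to[0,\infty)$ be a monotone (non-decreasing) function such that $g_1(x)\ge1$ for all $x>d$, and such that for all $z$ with $\mathrm{size}(z)>d$ and all $(y_1,\dots,y_n)$ in the support of the joint distribution of $(h_1(z),\dots,h_n(z))$, $$\sum_{i=1}^n g_1(\mathrm{size}(y_i))\le g_1(\mathrm{size}(z)).$$ Then for all $z\in I$ and $r\in\mathbb{R}$ such that $g_1(\mathrm{size}(z))\ge1$, $$\Pr[S(z)>r]\le g_1(\mathrm{size}(z))\cdot D_r(\mathrm{size}(z)),$$ where $D_r(x)$ is defined for $x\ge 0$ by: 1. if $r\le u(d)$ then $D_r(x)=1$; 2. if $r>u(d)$ then (a) if $x\le d$, $D_r(x)=0$; (b) if $x>d$ and $u(x)\ge r$, $D_r(x)=1$; (c) if $x>d$ and $u(x)<r$, $$D_r(x)=\left(\frac{m(x)}{x}\right)^{\left\lceil\frac{r-u(x)}{a(x)}\right\rceil}\cdot\frac{x}{u'\left(r-a(x)\left\lceil\frac{r-u(x)}{a(x)}\right\rceil\right)}.$$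
   Context: In the recurrence inequality, in the factor $\Pr[\max_i S(y_i)>\cdot]$, the variables $S(y_1),\dots,S(y_n)$ are taken on some common probability space with the given marginal laws; no independence is required. The nested expression $h_{i_1}(\cdots(h_{i_k}(z)))$ denotes the result of $k$ successive (freshly randomized) recursive splittings; the termination assumption is equivalent to: for every $z$ there is $k$ such that whenever $z=z_0,z_1,\dots,z_k$ is a sequence in which each $z_{j+1}$ is a value taken with positive probability by some $h_i(z_j)$, we have $\mathrm{size}(z_k)\le d$. -}

module Defs where

open import Algebra.Bundles using (CommutativeRing; Semiring)
import Algebra.Construct.NaturalChoice.Max as Max
import Algebra.Definitions.RawSemiring as RawSemiringDefs
open import Algebra.Structures using (IsCommutativeRing)
open import Axiom.ExcludedMiddle using (ExcludedMiddle)
open import Data.Bool.Base using (if_then_else_)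
open import Data.Fin.Base using (Fin)
open import Data.List.Base as List using (List)
open import Data.List.Relation.Unary.Unique.Propositional using (Unique)
open import Data.Nat.Base as ℕ using (ℕ; zero; suc)
open import Data.Product.Base using (∃; ∃-syntax; _×_; _,_)
open import Data.Sum.Base using (_⊎_; inj₁; inj₂; [_,_]′)
open import Data.Vec.Base as Vec using (Vec; []; _∷_; lookup)
open import Level using (0ℓ)
open import Relation.Binary.Bundles using (DecTotalOrder)
open import Relation.Binary.Core using (Rel)
import Relation.Binary.Construct.NonStrictToStrict as NonStrictToStrict
import Relation.Binary.Properties.DecTotalOrder as DecTotalOrderProperties
open import Relation.Binary.PropositionalEquality.Core using (_≡_; _≢_)
open import Relation.Binary.Structures using (IsDecTotalOrder)
open import Relation.Nullary.Decidable.Core using (yes; no; does)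
open import Relation.Nullary.Negation.Core using (¬_)
open import Relation.Unary using (Pred; U; ∁; ⋃; _≐_; _⊥_; _∪_)

-- The standard library has no real numbers.  They are characterised up to
-- isomorphism as the Dedekind-complete ordered field.  Equality is a setoid
-- equality, so that constructions of ℝ that would need a quotient are
-- models too; a map ℝ → ℝ is a function of real numbers if it preserves _≈_.

record CompleteOrderedField : Set₁ where
  infix  4 _≈_ _≤_
  infixl 6 _+_
  infixl 7 _*_
  infix  8 -_
  infix  9 _⁻¹
  field
    ℝ     : Set
    _≈_   : Rel ℝ 0ℓ
    _≤_   : Rel ℝ 0ℓ
    _+_   : ℝ → ℝ → ℝ
    _*_   : ℝ → ℝ → ℝ
    -_    : ℝ → ℝ
    0#    : ℝ
    1#    : ℝ
    _⁻¹   : ℝ → ℝ   -- the value at 0 is unspecified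

    isCommutativeRing : IsCommutativeRing _≈_ _+_ _*_ -_ 0# 1#
    isDecTotalOrder   : IsDecTotalOrder _≈_ _≤_

    0≉1        : ¬ 0# ≈ 1#
    ⁻¹-cong    : ∀ {x y} → x ≈ y → x ⁻¹ ≈ y ⁻¹
    ⁻¹-inverse : ∀ {x} → ¬ x ≈ 0# → x * x ⁻¹ ≈ 1#

    +-monoˡ-≤     : ∀ {x y} z → x ≤ y → x + z ≤ y + z
    *-nonNegative : ∀ {x y} → 0# ≤ x → 0# ≤ y → 0# ≤ x * y

  IsUpperBound : Pred ℝ 0ℓ → ℝ → Set
  IsUpperBound P b = ∀ x → P x → x ≤ b

  IsSupremum : Pred ℝ 0ℓ → ℝ → Set
  IsSupremum P s = IsUpperBound P s × (∀ b → IsUpperBound P b → s ≤ b)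

  field
    complete : (P : Pred ℝ 0ℓ) → ∃ P → ∃ (IsUpperBound P) → ∃ (IsSupremum P)

  commutativeRing : CommutativeRing 0ℓ 0ℓ
  commutativeRing = record { isCommutativeRing = isCommutativeRing }

  decTotalOrder : DecTotalOrder 0ℓ 0ℓ 0ℓ
  decTotalOrder = record { isDecTotalOrder = isDecTotalOrder }

  open CommutativeRing commutativeRing public
    using (_-_; semiring)
  open DecTotalOrder decTotalOrder public
    using (_≤?_; totalOrder)
  open DecTotalOrderProperties decTotalOrder public
    using (_<_)
  open Max totalOrder public
    using (_⊔_)
  open RawSemiringDefs (Semiring.rawSemiring semiring) public
    using (_^_) renaming (_×_ to _·_)

  infixl 7 _/_
  _/_ : ℝ → ℝ → ℝ
  x / y = x * y ⁻¹

  ∣_∣ : ℝ → ℝ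
  ∣ x ∣ = x ⊔ - x

  sum : ∀ {n} → Vec ℝ n → ℝ
  sum = Vec.foldr′ _+_ 0#

  maximum : ∀ {n} → Vec ℝ (suc n) → ℝ
  maximum = Vec.foldr₁ _⊔_

  MonotoneOn : Pred ℝ 0ℓ → (ℝ → ℝ) → Set
  MonotoneOn A f = ∀ x y → A x → A y → x ≤ y → f x ≤ f y

  ContinuousOn : Pred ℝ 0ℓ → (ℝ → ℝ) → Set
  ContinuousOn A f =
    ∀ x → A x → ∀ ε → 0# < ε →
    ∃[ δ ] 0# < δ × (∀ y → A y → ∣ y - x ∣ < δ → ∣ f y - f x ∣ < ε)

  ⟨_,∞⟩ : ℝ → Pred ℝ 0ℓ
  ⟨ c ,∞⟩ x = c < x

  -- Unordered sums of non-negative families over an arbitrary index type.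

  FinitePartialSum : {A : Set} → (A → ℝ) → Pred ℝ 0ℓ
  FinitePartialSum f x =
    ∃[ as ] Unique as × x ≈ List.foldr _+_ 0# (List.map f as)

  HasSum : {A : Set} → (A → ℝ) → ℝ → Set
  HasSum f = IsSupremum (FinitePartialSum f)

module Probability (lem : ExcludedMiddle 0ℓ) (R : CompleteOrderedField) where
  open CompleteOrderedField R

  choose : {A : Set} → Pred A 0ℓ → A → A
  choose P default with lem {∃ P}
  ... | yes (x , _) = x
  ... | no  _       = default

  -- The default is never reached below: only non-negative families with
  -- bounded partial sums are summed.
  ∑ : {A : Set} → (A → ℝ) → ℝ
  ∑ f = choose (HasSum f) 0#

  infix 5 ∑
  syntax ∑ (λ a → e) = ∑[ a ] e

  record ProbabilitySpace : Set₂ where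
    field
      Ω          : Set
      Measurable : Pred Ω 0ℓ → Set₁
      measurable-resp-≐ : ∀ {A B} → A ≐ B → Measurable A → Measurable B
      measurable-U : Measurable U
      measurable-∁ : ∀ {A} → Measurable A → Measurable (∁ A)
      measurable-⋃ : ∀ {A : ℕ → Pred Ω 0ℓ} →
                     (∀ k → Measurable (A k)) → Measurable (⋃ ℕ A)

      Pr : (A : Pred Ω 0ℓ) → Measurable A → ℝ
      Pr-cong        : ∀ {A B} (mA : Measurable A) (mB : Measurable B) →
                       A ≐ B → Pr A mA ≈ Pr B mB
      Pr-nonNegative : ∀ {A} (mA : Measurable A) → 0# ≤ Pr A mA
      Pr-U           : Pr U measurable-U ≈ 1#
      Pr-⋃           : ∀ {A : ℕ → Pred Ω 0ℓ} (mA : ∀ k → Measurable (A k)) →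
                       (∀ j k → j ≢ k → A j ⊥ A k) →
                       HasSum (λ k → Pr (A k) (mA k)) (Pr (⋃ ℕ A) (measurable-⋃ mA))

    measurable-∪ : ∀ {A B} → Measurable A → Measurable B → Measurable (A ∪ B)
    measurable-∪ {A} {B} mA mB =
      measurable-resp-≐
        ( (λ { (zero , a) → inj₁ a ; (suc _ , b) → inj₂ b })
        , [ (λ a → 0 , a) , (λ b → 1 , b) ]′ )
        (measurable-⋃ {A = λ { zero → A ; (suc _) → B }}
          λ { zero → mA ; (suc _) → mB })

  open ProbabilitySpace using (Ω; Measurable; Pr)

  record RealVariable (𝓟 : ProbabilitySpace) : Set₁ where
    field
      value      : Ω 𝓟 → ℝ
      measurable : ∀ r → Measurable 𝓟 (λ ω → r < value ω)

  record DiscreteVariable (𝓟 : ProbabilitySpace) (A : Set) : Set₁ where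
    field
      value      : Ω 𝓟 → A
      measurable : ∀ a → Measurable 𝓟 (λ ω → value ω ≡ a)
      range      : ℕ → A
      inRange    : Pr 𝓟 (⋃ ℕ λ k ω → value ω ≡ range k)
                        (ProbabilitySpace.measurable-⋃ 𝓟 λ k → measurable (range k))
                   ≈ 1#

  Pr[_>_] : ∀ {𝓟} → RealVariable 𝓟 → ℝ → ℝ
  Pr[_>_] {𝓟} X r = Pr 𝓟 (λ ω → r < RealVariable.value X ω) (RealVariable.measurable X r)

  Pr[_≡_] : ∀ {𝓟 A} → DiscreteVariable 𝓟 A → A → ℝ
  Pr[_≡_] {𝓟} X a = Pr 𝓟 (λ ω → DiscreteVariable.value X ω ≡ a) (DiscreteVariable.measurable X a)

  _∈Support_ : ∀ {𝓟 A} → A → DiscreteVariable 𝓟 A → Set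
  a ∈Support X = 0# < Pr[ X ≡ a ]

  𝔼[_∘_] : ∀ {𝓟 A} → (A → ℝ) → DiscreteVariable 𝓟 A → ℝ
  𝔼[ φ ∘ X ] = ∑[ a ] (Pr[ X ≡ a ] * φ a)

  _⊔ᵛ_ : ∀ {𝓟} → RealVariable 𝓟 → RealVariable 𝓟 → RealVariable 𝓟
  _⊔ᵛ_ {𝓟} X Y = record
    { value      = λ ω → X.value ω ⊔ Y.value ω
    ; measurable = λ r →
        ProbabilitySpace.measurable-resp-≐ 𝓟
          (∪⇒⊔ , ⊔⇒∪)
          (ProbabilitySpace.measurable-∪ 𝓟 (X.measurable r) (Y.measurable r))
    }
    where
    module X = RealVariable X
    module Y = RealVariable Y
    open Max totalOrder using (x≤x⊔y; x≤y⊔x; ⊔-sel)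
    open DecTotalOrderProperties decTotalOrder using (<-respʳ-≈)
    open DecTotalOrder decTotalOrder
      using (antisym; ≤-respʳ-≈; module Eq) renaming (trans to ≤-trans)
    open NonStrictToStrict _≈_ _≤_ using () renaming (<-≤-trans to mk-<-≤-trans)

    <-≤-trans : ∀ {x y z} → x < y → y ≤ z → x < z
    <-≤-trans = mk-<-≤-trans Eq.sym ≤-trans antisym ≤-respʳ-≈

    ∪⇒⊔ : ∀ {r ω} → (r < X.value ω) ⊎ (r < Y.value ω) → r < X.value ω ⊔ Y.value ω
    ∪⇒⊔ (inj₁ r<x) = <-≤-trans r<x (x≤x⊔y _ _)
    ∪⇒⊔ (inj₂ r<y) = <-≤-trans r<y (x≤y⊔x _ _)

    ⊔⇒∪ : ∀ {r ω} → r < X.value ω ⊔ Y.value ω → (r < X.value ω) ⊎ (r < Y.value ω)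
    ⊔⇒∪ {ω = ω} r<x⊔y with ⊔-sel (X.value ω) (Y.value ω)
    ... | inj₁ eq = inj₁ (<-respʳ-≈ eq r<x⊔y)
    ... | inj₂ eq = inj₂ (<-respʳ-≈ eq r<x⊔y)

  maxᵛ : ∀ {𝓟 n} → Vec (RealVariable 𝓟) (suc n) → RealVariable 𝓟
  maxᵛ = Vec.foldr₁ _⊔ᵛ_

  -- Copies of X₁, …, Xₙ on a common probability space.  A real distribution
  -- is determined by its tail function r ↦ Pr[X > r].
  record Coupling {n} {𝓟 : Fin n → ProbabilitySpace}
                  (X : ∀ i → RealVariable (𝓟 i)) : Set₂ where
    field
      space     : ProbabilitySpace
      variables : Vec (RealVariable space) n
      sameLaw   : ∀ i r → Pr[ lookup variables i > r ] ≈ Pr[ X i > r ]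

  -- Pr[size(hᵢ₁(⋯(hᵢₖ(z)))) > c], each splitting freshly randomised.  The
  -- word lists the indices in the order in which they are applied: iₖ, …, i₁.
  Pr-nested> : {I : Set} {n : ℕ} (size : I → ℝ) {𝓟 : I → ProbabilitySpace} →
               (∀ z → DiscreteVariable (𝓟 z) (Vec I n)) →
               ℝ → ∀ {k} → Vec (Fin n) k → I → ℝ
  Pr-nested> size h c []       z = if does (size z ≤? c) then 0# else 1#
  Pr-nested> size h c (i ∷ is) z =
    ∑[ y ] (Pr[ h z ≡ y ] * Pr-nested> size h c is (lookup y i))

  -- The least natural number that is at least x.  It is only applied to
  -- positive x, where it is the usual ceiling.
  ⌈_⌉ : ℝ → ℕ
  ⌈ x ⌉ = choose (λ k → x ≤ k · 1# × (∀ j → x ≤ j · 1# → k ℕ.≤ j)) 0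

  D : (d : ℝ) (a m u u′ : ℝ → ℝ) → ℝ → ℝ → ℝ
  D d a m u u′ r x =
    if does (r ≤? u d) then 1# else
    if does (x ≤? d)   then 0# else
    if does (r ≤? u x) then 1# else
      (m x / x) ^ k * (x / u′ (r - a x * (k · 1#)))
    where
    k : ℕ
    k = ⌈ (r - u x) / a x ⌉

-- For x > d write D_r(x) = slope · x with slope = (m x / x)^k / u′ (r - k a x),
-- where k = ⌈(r - u x) / a x⌉.  The slope is non-decreasing in x: this is clear
-- while k is constant, and where k drops by one, u x + k a x = r (intermediate
-- value theorem), the inequality u x ≥ a x + u (m x) compensates for the lost
-- factor m x / x.  Hence D_{r - a x}(y) ≤ c y for all d < y ≤ x, with c the slope
-- of D_{r - a x} at x, and c m x = D_r(x).  By induction on the depth of the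
-- splitting, the union bound over the parts and the superadditivity of g₁,
--   Pr[S z > r] ≤ E[∑ᵢ g₁(yᵢ) D_{r - a x}(yᵢ)] ≤ g₁(x) c E[maxᵢ yᵢ] ≤ g₁(x) c m x.

module Submission where

open import Defs
open import Algebra.Bundles using (CommutativeRing)
import Algebra.Construct.NaturalChoice.Max as Max
import Algebra.Properties.AbelianGroup as AbelianGroupProperties
import Algebra.Properties.Group as GroupProperties
import Algebra.Properties.Ring as RingProperties
import Algebra.Properties.Semiring.Mult as Mult
open import Axiom.ExcludedMiddle using (ExcludedMiddle)
open import Data.Fin.Base using (Fin; zero; suc)
open import Data.List.Base as List using (List; []; _∷_)
open import Data.List.Membership.Propositional using (_∈_)
open import Data.List.Relation.Unary.All as All using (All; []; _∷_)
open import Data.List.Relation.Unary.Any using (here; there)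
open import Data.List.Relation.Unary.Unique.Propositional using (Unique; []; _∷_)
open import Data.Nat.Base as ℕ using (ℕ; zero; suc)
import Data.Nat.Properties as ℕ
open import Data.Product.Base using (∃; ∃-syntax; _×_; _,_; proj₁; proj₂)
open import Data.Sum.Base using (_⊎_; inj₁; inj₂; [_,_]′)
open import Data.Unit.Base using (tt)
open import Data.Vec.Base as Vec using (Vec; []; _∷_; lookup)
open import Level using (0ℓ)
open import Relation.Binary.Bundles using (DecTotalOrder)
open import Relation.Binary.Core using (_Preserves_⟶_)
import Relation.Binary.Properties.DecTotalOrder as DecTotalOrderProperties
import Relation.Binary.Reasoning.PartialOrder as PartialOrderReasoning
open import Relation.Nullary.Decidable using (Dec; yes; no; dec-true; dec-false)
open import Relation.Nullary.Negation.Core using (¬_; contradiction)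
open import Relation.Binary.PropositionalEquality.Core as ≡ using (_≡_; _≢_; refl)
open import Relation.Unary using (Pred; U; ∁; ⋃; _≐_; _⊥_; _∪_; _⊆_)

-- The recurrence controls the parts of a splitting only through the expectation of their maximal
-- size, so a bound at the parts can be averaged only if it is linear in the size. `D` is not
-- linear; dominating it on all sizes up to x by a single line is what forces the study of the
-- slope. Two obstacles shape the rest. Ceilings of quotients are hard to compare at different
-- points, so the exponent k is described by comparing r with u x + k · a x, an expression that is
-- monotone and continuous in x; its crossings with r are exactly where k drops. And `u′` inverts
-- `u` only above u d, so every argument given to it must be shown to exceed u d. This always comes
-- from the same chain: subtracting one a x from something larger than u x leaves something larger
-- than u (m x), and u (m x) is at least u d, even if m x lies below d, because `u` is constant
-- there.

-- Arithmetic of an ordered field.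

module RealProperties (R : CompleteOrderedField) where

  open CompleteOrderedField R
  open CommutativeRing commutativeRing public
    using ( +-cong; +-congˡ; +-congʳ; +-assoc; +-comm; +-identityˡ; +-identityʳ
          ; *-congˡ; *-congʳ; *-assoc; *-comm; *-identityˡ; *-identityʳ
          ; zeroˡ; zeroʳ; distribˡ; distribʳ; -‿cong
          ; +-group; +-abelianGroup; ring)
    renaming (refl to ≈-refl; sym to ≈-sym; trans to ≈-trans)
  open DecTotalOrder decTotalOrder public
    using (poset; antisym; total)
    renaming (refl to ≤-refl; trans to ≤-trans; reflexive to ≤-reflexive)
  open DecTotalOrderProperties decTotalOrder public
    using (<⇒≱; ≰⇒>; ≮⇒≥; <-irrefl; <-trans; <-respˡ-≈; <-respʳ-≈)
  open Max totalOrder public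
    using (x≤x⊔y; x≤y⊔x; ⊔-sel; ⊔-lub)
  open PartialOrderReasoning poset public
  open AbelianGroupProperties +-abelianGroup using (xyx⁻¹≈y; ⁻¹-anti-homo‿-)
  open GroupProperties +-group using (⁻¹-involutive; //-rightDividesˡ; //-rightDividesʳ)
  open RingProperties ring using (-‿distribʳ-*)
  open Mult semiring using (×-comm-*; ×-congʳ)

  private
    variable
      x y z t : ℝ

  <⇒≤ : x < y → x ≤ y
  <⇒≤ = proj₁

  <-≤-trans : x < y → y ≤ z → x < z
  <-≤-trans {x} {y} {z} x<y y≤z = begin-strict x <⟨ x<y ⟩ y ≤⟨ y≤z ⟩ z ∎

  ≤-<-trans : x ≤ y → y < z → x < z
  ≤-<-trans {x} {y} {z} x≤y y<z = begin-strict x ≤⟨ x≤y ⟩ y <⟨ y<z ⟩ z ∎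

  x-y+y≈x : ∀ x y → x - y + y ≈ x
  x-y+y≈x x y = //-rightDividesˡ y x

  x+y-y≈x : ∀ x y → x + y - y ≈ x
  x+y-y≈x x y = //-rightDividesʳ y x

  +-monoʳ-≤ : ∀ z → x ≤ y → z + x ≤ z + y
  +-monoʳ-≤ {x} {y} z x≤y = begin
    z + x  ≈⟨ +-comm z x ⟩
    x + z  ≤⟨ +-monoˡ-≤ z x≤y ⟩
    y + z  ≈⟨ +-comm y z ⟩
    z + y  ∎

  +-mono-≤ : x ≤ y → z ≤ t → x + z ≤ y + t
  +-mono-≤ {y = y} {z} x≤y z≤t = ≤-trans (+-monoˡ-≤ z x≤y) (+-monoʳ-≤ y z≤t)

  +-cancelʳ-≤ : ∀ z → x + z ≤ y + z → x ≤ y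
  +-cancelʳ-≤ {x} {y} z x+z≤y+z = begin
    x          ≈⟨ x+y-y≈x x z ⟨
    x + z - z  ≤⟨ +-monoˡ-≤ (- z) x+z≤y+z ⟩
    y + z - z  ≈⟨ x+y-y≈x y z ⟩
    y          ∎

  +-cancelʳ-< : ∀ z → x + z < y + z → x < y
  +-cancelʳ-< z x+z<y+z = ≰⇒> λ y≤x → <⇒≱ x+z<y+z (+-monoˡ-≤ z y≤x)

  +-monoˡ-< : ∀ z → x < y → x + z < y + z
  +-monoˡ-< z x<y = ≰⇒> λ y+z≤x+z → <⇒≱ x<y (+-cancelʳ-≤ z y+z≤x+z)

  +-mono-< : x < y → z < t → x + z < y + t
  +-mono-< {x} {y} {z} {t} x<y z<t = begin-strict
    x + z  <⟨ +-monoˡ-< z x<y ⟩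
    y + z  ≤⟨ +-monoʳ-≤ y (<⇒≤ z<t) ⟩
    y + t  ∎

  x≤x+y : ∀ x → 0# ≤ y → x ≤ x + y
  x≤x+y {y} x 0≤y = begin
    x       ≈⟨ +-identityʳ x ⟨
    x + 0#  ≤⟨ +-monoʳ-≤ x 0≤y ⟩
    x + y   ∎

  x<x+y : ∀ x → 0# < y → x < x + y
  x<x+y {y} x 0<y = begin-strict
    x       ≈⟨ +-identityˡ x ⟨
    0# + x  <⟨ +-monoˡ-< x 0<y ⟩
    y + x   ≈⟨ +-comm y x ⟩
    x + y   ∎

  x≤y⇒0≤y-x : x ≤ y → 0# ≤ y - x
  x≤y⇒0≤y-x {x} {y} x≤y = +-cancelʳ-≤ x (begin
    0# + x     ≈⟨ +-identityˡ x ⟩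
    x          ≤⟨ x≤y ⟩
    y          ≈⟨ x-y+y≈x y x ⟨
    y - x + x  ∎)

  x<y⇒0<y-x : x < y → 0# < y - x
  x<y⇒0<y-x {x} {y} x<y = +-cancelʳ-< x (begin-strict
    0# + x     ≈⟨ +-identityˡ x ⟩
    x          <⟨ x<y ⟩
    y          ≈⟨ x-y+y≈x y x ⟨
    y - x + x  ∎)

  interchange : ∀ x y z w → (x + y) + (z + w) ≈ (x + z) + (y + w)
  interchange x y z w = begin-equality
    (x + y) + (z + w)  ≈⟨ +-assoc x y (z + w) ⟩
    x + (y + (z + w))  ≈⟨ +-congˡ (+-assoc y z w) ⟨
    x + ((y + z) + w)  ≈⟨ +-congˡ (+-congʳ (+-comm y z)) ⟩
    x + ((z + y) + w)  ≈⟨ +-congˡ (+-assoc z y w) ⟩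
    x + (z + (y + w))  ≈⟨ +-assoc x z (y + w) ⟨
    (x + z) + (y + w)  ∎

  *-monoʳ-≤ : 0# ≤ z → x ≤ y → z * x ≤ z * y
  *-monoʳ-≤ {z} {x} {y} 0≤z x≤y = begin
    z * x                  ≈⟨ +-identityˡ (z * x) ⟨
    0# + z * x             ≤⟨ +-monoˡ-≤ (z * x) (*-nonNegative 0≤z (x≤y⇒0≤y-x x≤y)) ⟩
    z * (y - x) + z * x    ≈⟨ distribˡ z (y - x) x ⟨
    z * (y - x + x)        ≈⟨ *-congˡ (x-y+y≈x y x) ⟩
    z * y                  ∎

  *-monoˡ-≤ : 0# ≤ z → x ≤ y → x * z ≤ y * z
  *-monoˡ-≤ {z} {x} {y} 0≤z x≤y = begin
    x * z  ≈⟨ *-comm x z ⟩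
    z * x  ≤⟨ *-monoʳ-≤ 0≤z x≤y ⟩
    z * y  ≈⟨ *-comm z y ⟩
    y * z  ∎

  *-mono-≤ : 0# ≤ x → 0# ≤ t → x ≤ y → z ≤ t → x * z ≤ y * t
  *-mono-≤ 0≤x 0≤t x≤y z≤t = ≤-trans (*-monoʳ-≤ 0≤x z≤t) (*-monoˡ-≤ 0≤t x≤y)

  x≤0⇒0≤-x : x ≤ 0# → 0# ≤ - x
  x≤0⇒0≤-x {x} x≤0 = begin
    0#      ≤⟨ x≤y⇒0≤y-x x≤0 ⟩
    0# - x  ≈⟨ +-identityˡ (- x) ⟩
    - x     ∎

  0≤1 : 0# ≤ 1#
  0≤1 with total 0# 1#
  ... | inj₁ 0≤1 = 0≤1
  ... | inj₂ 1≤0 = begin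
    0#             ≤⟨ *-nonNegative (x≤0⇒0≤-x 1≤0) (x≤0⇒0≤-x 1≤0) ⟩
    - 1# * - 1#    ≈⟨ -‿distribʳ-* (- 1#) 1# ⟨
    - (- 1# * 1#)  ≈⟨ -‿cong (*-identityʳ (- 1#)) ⟩
    - (- 1#)       ≈⟨ ⁻¹-involutive 1# ⟩
    1#             ∎

  0<1 : 0# < 1#
  0<1 = 0≤1 , 0≉1

  0<x⇒x≉0 : 0# < x → ¬ x ≈ 0#
  0<x⇒x≉0 0<x x≈0 = proj₂ 0<x (≈-sym x≈0)

  x*x⁻¹≈1 : 0# < x → x * x ⁻¹ ≈ 1#
  x*x⁻¹≈1 0<x = ⁻¹-inverse (0<x⇒x≉0 0<x)

  x⁻¹-nonNegative : 0# < x → 0# ≤ x ⁻¹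
  x⁻¹-nonNegative {x} 0<x with total 0# (x ⁻¹)
  ... | inj₁ 0≤x⁻¹ = 0≤x⁻¹
  ... | inj₂ x⁻¹≤0 = contradiction 1≤0 (<⇒≱ 0<1)
    where
    1≤0 : 1# ≤ 0#
    1≤0 = begin
      1#        ≈⟨ x*x⁻¹≈1 0<x ⟨
      x * x ⁻¹  ≤⟨ *-monoʳ-≤ (<⇒≤ 0<x) x⁻¹≤0 ⟩
      x * 0#    ≈⟨ zeroʳ x ⟩
      0#        ∎

  x*y⁻¹*y≈x : ∀ x → 0# < y → x * y ⁻¹ * y ≈ x
  x*y⁻¹*y≈x {y} x 0<y = begin-equality
    x * y ⁻¹ * y    ≈⟨ *-assoc x (y ⁻¹) y ⟩
    x * (y ⁻¹ * y)  ≈⟨ *-congˡ (≈-trans (*-comm (y ⁻¹) y) (x*x⁻¹≈1 0<y)) ⟩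
    x * 1#          ≈⟨ *-identityʳ x ⟩
    x               ∎

  ≤⇒/≤1 : 0# < y → x ≤ y → x / y ≤ 1#
  ≤⇒/≤1 {y} {x} 0<y x≤y = begin
    x * y ⁻¹  ≤⟨ *-monoˡ-≤ (x⁻¹-nonNegative 0<y) x≤y ⟩
    y * y ⁻¹  ≈⟨ x*x⁻¹≈1 0<y ⟩
    1#        ∎

  ≤⇒1≤/ : 0# < y → y ≤ x → 1# ≤ x / y
  ≤⇒1≤/ {y} {x} 0<y y≤x = begin
    1#        ≈⟨ x*x⁻¹≈1 0<y ⟨
    y * y ⁻¹  ≤⟨ *-monoˡ-≤ (x⁻¹-nonNegative 0<y) y≤x ⟩
    x * y ⁻¹  ∎

  ⁻¹-anti-≤ : 0# < x → x ≤ y → y ⁻¹ ≤ x ⁻¹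
  ⁻¹-anti-≤ {x} {y} 0<x x≤y = begin
    y ⁻¹               ≈⟨ *-identityˡ (y ⁻¹) ⟨
    1# * y ⁻¹          ≈⟨ *-congʳ (x*x⁻¹≈1 0<x) ⟨
    x * x ⁻¹ * y ⁻¹    ≈⟨ *-congʳ (*-comm x (x ⁻¹)) ⟩
    x ⁻¹ * x * y ⁻¹    ≈⟨ *-assoc (x ⁻¹) x (y ⁻¹) ⟩
    x ⁻¹ * (x / y)     ≤⟨ *-monoʳ-≤ (x⁻¹-nonNegative 0<x) (≤⇒/≤1 (<-≤-trans 0<x x≤y) x≤y) ⟩
    x ⁻¹ * 1#          ≈⟨ *-identityʳ (x ⁻¹) ⟩
    x ⁻¹               ∎

  /≤⇒≤* : 0# < y → x / y ≤ z → x ≤ z * y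
  /≤⇒≤* {y} {x} {z} 0<y x/y≤z = begin
    x             ≈⟨ x*y⁻¹*y≈x x 0<y ⟨
    x * y ⁻¹ * y  ≤⟨ *-monoˡ-≤ (<⇒≤ 0<y) x/y≤z ⟩
    z * y         ∎

  ≤*⇒/≤ : 0# < y → x ≤ z * y → x / y ≤ z
  ≤*⇒/≤ {y} {x} {z} 0<y x≤zy = begin
    x * y ⁻¹        ≤⟨ *-monoˡ-≤ (x⁻¹-nonNegative 0<y) x≤zy ⟩
    z * y * y ⁻¹    ≈⟨ *-assoc z y (y ⁻¹) ⟩
    z * (y * y ⁻¹)  ≈⟨ *-congˡ (x*x⁻¹≈1 0<y) ⟩
    z * 1#          ≈⟨ *-identityʳ z ⟩
    z               ∎

  ^-nonNegative : ∀ k → 0# ≤ x → 0# ≤ x ^ k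
  ^-nonNegative zero    _   = 0≤1
  ^-nonNegative (suc k) 0≤x = *-nonNegative 0≤x (^-nonNegative k 0≤x)

  ^-monoˡ-≤ : ∀ k → 0# ≤ x → x ≤ y → x ^ k ≤ y ^ k
  ^-monoˡ-≤ zero    _   _   = ≤-refl
  ^-monoˡ-≤ (suc k) 0≤x x≤y =
    *-mono-≤ 0≤x (^-nonNegative k (≤-trans 0≤x x≤y)) x≤y (^-monoˡ-≤ k 0≤x x≤y)

  ·-nonNegative : ∀ k → 0# ≤ x → 0# ≤ k · x
  ·-nonNegative zero        _   = ≤-refl
  ·-nonNegative {x} (suc k) 0≤x = ≤-trans 0≤x (x≤x+y x (·-nonNegative k 0≤x))

  ·-monoʳ-≤ : ∀ k → x ≤ y → k · x ≤ k · y
  ·-monoʳ-≤ zero    _   = ≤-refl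
  ·-monoʳ-≤ (suc k) x≤y = +-mono-≤ x≤y (·-monoʳ-≤ k x≤y)

  ·-monoˡ-≤ : ∀ {j k} → 0# ≤ x → j ℕ.≤ k → j · x ≤ k · x
  ·-monoˡ-≤ {k = k} 0≤x ℕ.z≤n       = ·-nonNegative k 0≤x
  ·-monoˡ-≤ {x}     0≤x (ℕ.s≤s j≤k) = +-monoʳ-≤ x (·-monoˡ-≤ 0≤x j≤k)

  -- Links the product with a numeral that occurs in `D` to the repeated sum on which induction over
  -- k works.
  x*k·1≈k·x : ∀ k x → x * (k · 1#) ≈ k · x
  x*k·1≈k·x k x = ≈-trans (×-comm-* k x 1#) (×-congʳ k (*-identityʳ x))

  half : ℝ → ℝ
  half x = x / (1# + 1#)

  0<2 : 0# < 1# + 1#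
  0<2 = <-trans 0<1 (x<x+y 1# 0<1)

  half+half≈x : ∀ x → half x + half x ≈ x
  half+half≈x x = begin-equality
    half x + half x              ≈⟨ +-cong (*-identityʳ _) (*-identityʳ _) ⟨
    half x * 1# + half x * 1#    ≈⟨ distribˡ (half x) 1# 1# ⟨
    half x * (1# + 1#)           ≈⟨ x*y⁻¹*y≈x x 0<2 ⟩
    x                            ∎

  half-positive : 0# < x → 0# < half x
  half-positive {x} 0<x = ≰⇒> λ half≤0 → <⇒≱ 0<x (begin
    x                ≈⟨ half+half≈x x ⟨
    half x + half x  ≤⟨ +-mono-≤ half≤0 half≤0 ⟩
    0# + 0#          ≈⟨ +-identityˡ 0# ⟩
    0#               ∎)

  half-< : 0# < x → half x < x
  half-< {x} 0<x = <-respʳ-≈ (half+half≈x x) (x<x+y (half x) (half-positive 0<x))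

  x+half<x+ : ∀ x → 0# < y → x + half y < x + y
  x+half<x+ {y} x 0<y = begin-strict
    x + half y  ≈⟨ +-comm x (half y) ⟩
    half y + x  <⟨ +-monoˡ-< x (half-< 0<y) ⟩
    y + x       ≈⟨ +-comm y x ⟩
    x + y       ∎

  -- Continuity, intermediate values and the Archimedean property.

  -- Two one-sided inequalities in place of an absolute value: closeness of sums then follows by
  -- adding strict inequalities.
  Near : ℝ → ℝ → ℝ → Set
  Near ε x y = x < y + ε × y < x + ε

  ∣y-x∣<ε⇒Near : ∀ {ε} → ∣ y - x ∣ < ε → Near ε x y
  ∣y-x∣<ε⇒Near {y} {x} {ε} ∣y-x∣<ε = +-cancelʳ-< (- y) x-y<y+ε-y , +-cancelʳ-< (- x) y-x<x+ε-x
    where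
    y-x<x+ε-x : y - x < x + ε - x
    y-x<x+ε-x = begin-strict
      y - x            ≤⟨ x≤x⊔y (y - x) (- (y - x)) ⟩
      ∣ y - x ∣        <⟨ ∣y-x∣<ε ⟩
      ε                ≈⟨ xyx⁻¹≈y x ε ⟨
      x + ε - x        ∎
    x-y<y+ε-y : x - y < y + ε - y
    x-y<y+ε-y = begin-strict
      x - y            ≈⟨ ⁻¹-anti-homo‿- y x ⟨
      - (y - x)        ≤⟨ x≤y⊔x (y - x) (- (y - x)) ⟩
      ∣ y - x ∣        <⟨ ∣y-x∣<ε ⟩
      ε                ≈⟨ xyx⁻¹≈y y ε ⟨
      y + ε - y        ∎

  Near⇒∣y-x∣<ε : ∀ {ε} → Near ε x y → ∣ y - x ∣ < ε
  Near⇒∣y-x∣<ε {x} {y} {ε} (x<y+ε , y<x+ε) with ⊔-sel (y - x) (- (y - x))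
  ... | inj₁ eq = <-respˡ-≈ (≈-sym eq) (+-cancelʳ-< x (begin-strict
    y - x + x        ≈⟨ x-y+y≈x y x ⟩
    y                <⟨ y<x+ε ⟩
    x + ε            ≈⟨ +-comm x ε ⟩
    ε + x            ∎))
  ... | inj₂ eq = <-respˡ-≈ (≈-sym eq) (+-cancelʳ-< y (begin-strict
    - (y - x) + y    ≈⟨ +-congʳ (⁻¹-anti-homo‿- y x) ⟩
    x - y + y        ≈⟨ x-y+y≈x x y ⟩
    x                <⟨ x<y+ε ⟩
    y + ε            ≈⟨ +-comm y ε ⟩
    ε + y            ∎))

  Near-+ : ∀ {x₁ x₂ y₁ y₂ ε} → Near (half ε) x₁ y₁ → Near (half ε) x₂ y₂ → Near ε (x₁ + x₂) (y₁ + y₂)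
  Near-+ {x₁} {x₂} {y₁} {y₂} {ε} (x₁< , y₁<) (x₂< , y₂<) = bound x₁< x₂< , bound y₁< y₂<
    where
    bound : ∀ {a₁ a₂ b₁ b₂} → a₁ < b₁ + half ε → a₂ < b₂ + half ε → a₁ + a₂ < b₁ + b₂ + ε
    bound {a₁} {a₂} {b₁} {b₂} a₁< a₂< = begin-strict
      a₁ + a₂                            <⟨ +-mono-< a₁< a₂< ⟩
      (b₁ + half ε) + (b₂ + half ε)      ≈⟨ interchange b₁ (half ε) b₂ (half ε) ⟩
      (b₁ + b₂) + (half ε + half ε)      ≈⟨ +-congˡ (half+half≈x ε) ⟩
      b₁ + b₂ + ε                        ∎

  continuousOn-+ : ∀ {A f g} → ContinuousOn A f → ContinuousOn A g → ContinuousOn A (λ x → f x + g x)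
  continuousOn-+ f-cont g-cont x x∈A ε 0<ε
    with f-cont x x∈A (half ε) (half-positive 0<ε) | g-cont x x∈A (half ε) (half-positive 0<ε)
  ... | δ₁ , 0<δ₁ , f-near | δ₂ , 0<δ₂ , g-near with total δ₁ δ₂
  ... | inj₁ δ₁≤δ₂ = δ₁ , 0<δ₁ , λ y y∈A d<δ₁ → Near⇒∣y-x∣<ε
        (Near-+ (∣y-x∣<ε⇒Near (f-near y y∈A d<δ₁)) (∣y-x∣<ε⇒Near (g-near y y∈A (<-≤-trans d<δ₁ δ₁≤δ₂))))
  ... | inj₂ δ₂≤δ₁ = δ₂ , 0<δ₂ , λ y y∈A d<δ₂ → Near⇒∣y-x∣<ε
        (Near-+ (∣y-x∣<ε⇒Near (f-near y y∈A (<-≤-trans d<δ₂ δ₂≤δ₁))) (∣y-x∣<ε⇒Near (g-near y y∈A d<δ₂)))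

  continuousOn-· : ∀ {A f} k → ContinuousOn A f → ContinuousOn A (λ x → k · f x)
  continuousOn-· zero    f-cont x x∈A ε 0<ε =
    1# , 0<1 , λ _ _ _ → Near⇒∣y-x∣<ε (x<x+y 0# 0<ε , x<x+y 0# 0<ε)
  continuousOn-· (suc k) f-cont = continuousOn-+ f-cont (continuousOn-· k f-cont)

  -- The witness s is the supremum of the points of [x, y] at which f is at most r; continuity at s
  -- excludes both strict inequalities. It later locates the points where the exponent in `D` drops.
  intermediateValue : ∀ {c f} → MonotoneOn ⟨ c ,∞⟩ f → ContinuousOn ⟨ c ,∞⟩ f →
                      ∀ {x y r} → c < x → x ≤ y → f x ≤ r → r ≤ f y →
                      ∃[ s ] x ≤ s × s ≤ y × f s ≈ r
  intermediateValue {c} {f} f-mono f-cont {x} {y} {r} c<x x≤y fx≤r r≤fy =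
    s , x≤s , s≤y , fs≈r
    where
    Below : Pred ℝ 0ℓ
    Below w = x ≤ w × w ≤ y × f w ≤ r

    sup : ∃ (IsSupremum Below)
    sup = complete Below (x , ≤-refl , x≤y , fx≤r) (y , λ _ → λ (_ , w≤y , _) → w≤y)

    s : ℝ
    s = proj₁ sup

    upper : IsUpperBound Below s
    upper = proj₁ (proj₂ sup)

    least : ∀ b → IsUpperBound Below b → s ≤ b
    least = proj₂ (proj₂ sup)

    x≤s : x ≤ s
    x≤s = upper x (≤-refl , x≤y , fx≤r)

    s≤y : s ≤ y
    s≤y = least y (λ _ → λ (_ , w≤y , _) → w≤y)

    c<s : c < s
    c<s = <-≤-trans c<x x≤s

    fs≮r : ¬ f s < r
    fs≮r fs<r with f-cont s c<s (r - f s) (x<y⇒0<y-x fs<r)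
    -- A point slightly to the right of s still has a value below r. If that point overshoots y,
    -- then y itself is within δ of s, and f y < r is the contradiction.
    ... | δ , 0<δ , near with total (s + half δ) y
    ... | inj₁ w≤y = <⇒≱ s<w (upper w (≤-trans x≤s (<⇒≤ s<w) , w≤y , <⇒≤ fw<r))
      where
      w : ℝ
      w = s + half δ
      s<w : s < w
      s<w = x<x+y s (half-positive 0<δ)
      fw<r : f w < r
      fw<r = begin-strict
        f w              <⟨ proj₂ (∣y-x∣<ε⇒Near (near w (<-trans c<s s<w) (Near⇒∣y-x∣<ε
                              (<-trans s<w (x<x+y w 0<δ) , x+half<x+ s 0<δ)))) ⟩
        f s + (r - f s)  ≈⟨ +-comm (f s) (r - f s) ⟩
        r - f s + f s    ≈⟨ x-y+y≈x r (f s) ⟩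
        r                ∎
    ... | inj₂ y≤w = <⇒≱ fy<r r≤fy
      where
      y<s+δ : y < s + δ
      y<s+δ = ≤-<-trans y≤w (x+half<x+ s 0<δ)
      fy<r : f y < r
      fy<r = begin-strict
        f y              <⟨ proj₂ (∣y-x∣<ε⇒Near (near y (<-≤-trans c<s s≤y) (Near⇒∣y-x∣<ε
                              (≤-<-trans s≤y (x<x+y y 0<δ) , y<s+δ)))) ⟩
        f s + (r - f s)  ≈⟨ +-comm (f s) (r - f s) ⟩
        r - f s + f s    ≈⟨ x-y+y≈x r (f s) ⟩
        r                ∎

    r≮fs : ¬ r < f s
    r≮fs r<fs with f-cont s c<s (f s - r) (x<y⇒0<y-x r<fs)
    -- On the part of the domain between s - half δ and s, f stays above r, so s - half δ is already
    -- an upper bound of `Below`.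
    ... | δ , 0<δ , near = <⇒≱ w<s (least w w-upper)
      where
      w : ℝ
      w = s - half δ
      w+half≈s : w + half δ ≈ s
      w+half≈s = x-y+y≈x s (half δ)
      w<s : w < s
      w<s = <-respʳ-≈ w+half≈s (x<x+y w (half-positive 0<δ))
      s<w+δ : s < w + δ
      s<w+δ = begin-strict
        s           ≈⟨ w+half≈s ⟨
        w + half δ  <⟨ x+half<x+ w 0<δ ⟩
        w + δ       ∎
      r<f : ∀ {v} → c < v → w ≤ v → v ≤ s → r < f v
      r<f {v} c<v w≤v v≤s = +-cancelʳ-< (f s - r) (begin-strict
        r + (f s - r)    ≈⟨ +-comm r (f s - r) ⟩
        f s - r + r      ≈⟨ x-y+y≈x (f s) r ⟩
        f s              <⟨ proj₁ (∣y-x∣<ε⇒Near (near v c<v (Near⇒∣y-x∣<ε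
                              (<-≤-trans s<w+δ (+-monoˡ-≤ δ w≤v) , ≤-<-trans v≤s (x<x+y s 0<δ))))) ⟩
        f v + (f s - r)  ∎)
      w-upper : IsUpperBound Below w
      w-upper v (x≤v , v≤y , fv≤r) = ≮⇒≥ λ w<v →
        <⇒≱ (r<f (<-≤-trans c<x x≤v) (<⇒≤ w<v) (upper v (x≤v , v≤y , fv≤r))) fv≤r

    fs≈r : f s ≈ r
    fs≈r = antisym (≮⇒≥ r≮fs) (≮⇒≥ fs≮r)

  -- The Archimedean property, from completeness: if s were the supremum of the multiples of 1, then
  -- s - 1 would bound them too, since the successor of a multiple is a multiple.
  ¬-bounded-multiples : ∀ b → ¬ (∀ k → k · 1# ≤ b)
  ¬-bounded-multiples b k≤b = <⇒≱ s-1<s (s-least (s - 1#) upper)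
    where
    Multiple : Pred ℝ 0ℓ
    Multiple x = ∃[ k ] x ≈ k · 1#
    sup : ∃ (IsSupremum Multiple)
    sup = complete Multiple (0# , 0 , ≈-refl)
            (b , λ x → λ (k , x≈k) → ≤-trans (≤-reflexive x≈k) (k≤b k))
    s : ℝ
    s = proj₁ sup
    s-upper : IsUpperBound Multiple s
    s-upper = proj₁ (proj₂ sup)
    s-least : ∀ b → IsUpperBound Multiple b → s ≤ b
    s-least = proj₂ (proj₂ sup)
    s-1<s : s - 1# < s
    s-1<s = <-respʳ-≈ (x-y+y≈x s 1#) (x<x+y (s - 1#) 0<1)
    upper : IsUpperBound Multiple (s - 1#)
    upper x (k , x≈k) = +-cancelʳ-≤ 1# (begin
      x + 1#         ≈⟨ +-congʳ x≈k ⟩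
      k · 1# + 1#    ≈⟨ +-comm (k · 1#) 1# ⟩
      suc k · 1#     ≤⟨ s-upper (suc k · 1#) (suc k , ≈-refl) ⟩
      s              ≈⟨ x-y+y≈x s 1# ⟨
      s - 1# + 1#    ∎)

least-natural : ∀ {P : Pred ℕ 0ℓ} → (∀ k → Dec (P k)) → ∀ k → P k →
                ∃[ j ] P j × (∀ i → P i → j ℕ.≤ i)
least-natural {P} P? zero    Pk = 0 , Pk , λ _ _ → ℕ.z≤n
least-natural {P} P? (suc k) Pk with P? 0
... | yes P0 = 0 , P0 , λ _ _ → ℕ.z≤n
... | no ¬P0 with least-natural {λ j → P (suc j)} (λ j → P? (suc j)) k Pk
...   | j , Pj , j-least = suc j , Pj , λ
        { zero    P0 → contradiction P0 ¬P0
        ; (suc i) Pi → ℕ.s≤s (j-least i Pi)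
        }

-- Ceilings and unordered sums.

module ProbabilityProperties (lem : ExcludedMiddle 0ℓ) (R : CompleteOrderedField) where

  open CompleteOrderedField R
  open RealProperties R
  open Probability lem R

  choose-satisfies : {A : Set} (P : Pred A 0ℓ) (default : A) → ∃ P → P (choose P default)
  choose-satisfies P default ∃P with lem {∃ P}
  ... | yes (_ , Px) = Px
  ... | no  ∄P       = contradiction ∃P ∄P

  -- By the Archimedean property some natural number qualifies, hence a least one does, and `choose`
  -- does not fall back on its default.
  ⌈⌉-spec : ∀ x → x ≤ ⌈ x ⌉ · 1# × (∀ j → x ≤ j · 1# → ⌈ x ⌉ ℕ.≤ j)
  ⌈⌉-spec x = choose-satisfies _ 0 least
    where
    least : ∃[ k ] x ≤ k · 1# × (∀ j → x ≤ j · 1# → k ℕ.≤ j)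
    least with lem {∃[ k ] x ≤ k · 1#}
    ... | yes (k , x≤k) = least-natural (λ k → x ≤? k · 1#) k x≤k
    ... | no  ∄k        = contradiction
          (λ k → <⇒≤ (≰⇒> λ x≤k → ∄k (k , x≤k))) (¬-bounded-multiples x)

  module _ {A : Set} where

    sumOver : (A → ℝ) → List A → ℝ
    sumOver f as = List.foldr _+_ 0# (List.map f as)

    sumOver-mono : ∀ {f g} → (∀ a → f a ≤ g a) → ∀ as → sumOver f as ≤ sumOver g as
    sumOver-mono f≤g []       = ≤-refl
    sumOver-mono f≤g (a ∷ as) = +-mono-≤ (f≤g a) (sumOver-mono f≤g as)

    sumOver-+ : ∀ f g as → sumOver (λ a → f a + g a) as ≈ sumOver f as + sumOver g as
    sumOver-+ f g []       = ≈-sym (+-identityˡ 0#)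
    sumOver-+ f g (a ∷ as) = ≈-trans (+-congˡ (sumOver-+ f g as)) (interchange (f a) (g a) _ _)

    sumOver-* : ∀ c f as → sumOver (λ a → c * f a) as ≈ c * sumOver f as
    sumOver-* c f []       = ≈-sym (zeroʳ c)
    sumOver-* c f (a ∷ as) = ≈-trans (+-congˡ (sumOver-* c f as)) (≈-sym (distribˡ c (f a) _))

    -- Any such bound makes the supremum behind `∑` exist, by completeness. It is therefore carried
    -- along wherever a value of `∑` is used.
    PartialSums≤ : (A → ℝ) → ℝ → Set
    PartialSums≤ f b = ∀ as → Unique as → sumOver f as ≤ b

    ∑-hasSum : ∀ {f b} → PartialSums≤ f b → HasSum f (∑ f)
    ∑-hasSum {f} {b} f≤b = choose-satisfies (HasSum f) 0#
      (complete (FinitePartialSum f) (0# , [] , [] , ≈-refl)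
        (b , λ x → λ (as , unique , x≈) → ≤-trans (≤-reflexive x≈) (f≤b as unique)))

    partialSum≤∑ : ∀ {f b} → PartialSums≤ f b → PartialSums≤ f (∑ f)
    partialSum≤∑ f≤b as unique = proj₁ (∑-hasSum f≤b) _ (as , unique , ≈-refl)

    ∑≤ : ∀ {f b} → PartialSums≤ f b → ∑ f ≤ b
    ∑≤ f≤b = proj₂ (∑-hasSum f≤b) _
      λ x → λ (as , unique , x≈) → ≤-trans (≤-reflexive x≈) (f≤b as unique)

  -- Two point masses dominate the probabilities of a padded pair of events, which bounds their sum
  -- over every duplicate-free list of indices at once.
  pointMass : ℕ → ℝ → ℕ → ℝ
  pointMass i c j with i ℕ.≟ j
  ... | yes _ = c
  ... | no  _ = 0#

  sumOver-pointMass-≢ : ∀ i c {js} → All (i ≢_) js → sumOver (pointMass i c) js ≈ 0#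
  sumOver-pointMass-≢ i c []                      = ≈-refl
  sumOver-pointMass-≢ i c (_∷_ {x = j} i≢j i≢js) with i ℕ.≟ j
  ... | yes i≡j = contradiction i≡j i≢j
  ... | no  _   = ≈-trans (+-identityˡ _) (sumOver-pointMass-≢ i c i≢js)

  sumOver-pointMass : ∀ i {c} → 0# ≤ c → PartialSums≤ (pointMass i c) c
  sumOver-pointMass i     0≤c []       []              = 0≤c
  sumOver-pointMass i {c} 0≤c (j ∷ js) (j≢js ∷ unique) with i ℕ.≟ j
  ... | yes refl = begin
    c + sumOver (pointMass i c) js  ≈⟨ +-congˡ (sumOver-pointMass-≢ i c j≢js) ⟩
    c + 0#                          ≈⟨ +-identityʳ c ⟩
    c                               ∎
  ... | no _ = ≤-trans (≤-reflexive (+-identityˡ _)) (sumOver-pointMass i 0≤c js unique)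

  -- Finite additivity, monotonicity and the union bound.

  module _ (𝓟 : ProbabilitySpace) where
    open ProbabilitySpace 𝓟

    private
      variable
        A B : Pred Ω 0ℓ

    infixr 5 _then_
    -- Additivity is given for sequences of events only, so a pair is padded with the empty event
    -- `∁ U`.
    _then_ : Pred Ω 0ℓ → Pred Ω 0ℓ → ℕ → Pred Ω 0ℓ
    (A then B) 0             = A
    (A then B) 1             = B
    (A then B) (suc (suc _)) = ∁ U

    measurable-then : Measurable A → Measurable B → ∀ k → Measurable ((A then B) k)
    measurable-then mA mB 0             = mA
    measurable-then mA mB 1             = mB
    measurable-then mA mB (suc (suc _)) = measurable-∁ measurable-U

    then-disjoint : A ⊥ B → ∀ j k → j ≢ k → (A then B) j ⊥ (A then B) k
    then-disjoint A⊥B 0             0             j≢k _       = j≢k refl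
    then-disjoint A⊥B 0             1             _   (a , b) = A⊥B (a , b)
    then-disjoint A⊥B 1             0             _   (b , a) = A⊥B (a , b)
    then-disjoint A⊥B 1             1             j≢k _       = j≢k refl
    then-disjoint A⊥B _             (suc (suc _)) _   (_ , n) = n tt
    then-disjoint A⊥B (suc (suc _)) _             _   (n , _) = n tt

    ⋃-then : ⋃ ℕ (A then B) ≐ A ∪ B
    ⋃-then = (λ { (0 , a) → inj₁ a ; (1 , b) → inj₂ b ; (suc (suc _) , n) → contradiction tt n })
           , (λ { (inj₁ a) → 0 , a ; (inj₂ b) → 1 , b })

    Pr-⊎-hasSum : (mA : Measurable A) (mB : Measurable B) → A ⊥ B →
                  HasSum (λ k → Pr ((A then B) k) (measurable-then mA mB k))
                         (Pr (⋃ ℕ (A then B)) (measurable-⋃ (measurable-then mA mB)))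
    Pr-⊎-hasSum mA mB A⊥B = Pr-⋃ (measurable-then mA mB) (then-disjoint A⊥B)

    -- The indices 0 and 1 alone form a finite partial sum, so this half needs no knowledge of the
    -- padding. It yields `Pr-∅`, on which the opposite half relies.
    Pr-⊎-≥ : (mA : Measurable A) (mB : Measurable B) (m∪ : Measurable (A ∪ B)) → A ⊥ B →
             Pr A mA + Pr B mB ≤ Pr (A ∪ B) m∪
    Pr-⊎-≥ {A} {B} mA mB m∪ A⊥B = begin
      Pr A mA + Pr B mB                                           ≈⟨ +-congˡ (+-identityʳ _) ⟨
      Pr A mA + (Pr B mB + 0#)                                    ≤⟨ proj₁ (Pr-⊎-hasSum mA mB A⊥B) _
        (0 ∷ 1 ∷ [] , ((λ ()) ∷ []) ∷ [] ∷ [] , ≈-refl) ⟩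
      Pr (⋃ ℕ (A then B)) (measurable-⋃ (measurable-then mA mB))  ≈⟨ Pr-cong _ m∪ ⋃-then ⟩
      Pr (A ∪ B) m∪                                               ∎

    Pr-∅ : (m∅ : Measurable (∁ U)) → Pr (∁ U) m∅ ≤ 0#
    Pr-∅ m∅ = +-cancelʳ-≤ 1# (begin
      Pr (∁ U) m∅ + 1#                                  ≈⟨ +-congˡ Pr-U ⟨
      Pr (∁ U) m∅ + Pr U measurable-U                   ≤⟨ Pr-⊎-≥ m∅ measurable-U m∪ (λ (n , _) → n tt) ⟩
      Pr (∁ U ∪ U) m∪                                   ≈⟨ Pr-cong m∪ measurable-U ((λ _ → tt) , inj₂) ⟩
      Pr U measurable-U                                 ≈⟨ Pr-U ⟩
      1#                                                ≈⟨ +-identityˡ 1# ⟨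
      0# + 1#                                           ∎)
      where
      m∪ : Measurable (∁ U ∪ U)
      m∪ = measurable-∪ m∅ measurable-U

    Pr-⊎-≤ : (mA : Measurable A) (mB : Measurable B) (m∪ : Measurable (A ∪ B)) → A ⊥ B →
             Pr (A ∪ B) m∪ ≤ Pr A mA + Pr B mB
    Pr-⊎-≤ {A} {B} mA mB m∪ A⊥B = begin
      Pr (A ∪ B) m∪                                               ≈⟨ Pr-cong _ m∪ ⋃-then ⟨
      Pr (⋃ ℕ (A then B)) (measurable-⋃ (measurable-then mA mB))  ≤⟨ proj₂ (Pr-⊎-hasSum mA mB A⊥B) _
        (λ x → λ (ks , unique , x≈) → ≤-trans (≤-reflexive x≈) (bound ks unique)) ⟩
      a + b                                                       ∎
      where
      a b : ℝ
      a = Pr A mA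
      b = Pr B mB
      pointwise : ∀ k → Pr ((A then B) k) (measurable-then mA mB k) ≤ pointMass 0 a k + pointMass 1 b k
      pointwise 0             = x≤x+y a ≤-refl
      pointwise 1             = ≤-reflexive (≈-sym (+-identityˡ b))
      pointwise (suc (suc _)) = ≤-trans (Pr-∅ _) (x≤x+y 0# ≤-refl)
      bound : PartialSums≤ (λ k → Pr ((A then B) k) (measurable-then mA mB k)) (a + b)
      bound ks unique = begin
        sumOver (λ k → Pr ((A then B) k) (measurable-then mA mB k)) ks  ≤⟨ sumOver-mono pointwise ks ⟩
        sumOver (λ k → pointMass 0 a k + pointMass 1 b k) ks            ≈⟨ sumOver-+ (pointMass 0 a) (pointMass 1 b) ks ⟩
        sumOver (pointMass 0 a) ks + sumOver (pointMass 1 b) ks         ≤⟨ +-mono-≤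
          (sumOver-pointMass 0 (Pr-nonNegative mA) ks unique) (sumOver-pointMass 1 (Pr-nonNegative mB) ks unique) ⟩
        a + b                                                           ∎

    infixl 6 _∖_
    -- Built from complement and union so that measurability is immediate; the price is a use of
    -- excluded middle to recover membership in B.
    _∖_ : Pred Ω 0ℓ → Pred Ω 0ℓ → Pred Ω 0ℓ
    B ∖ A = ∁ (∁ B ∪ A)

    measurable-∖ : Measurable B → Measurable A → Measurable (B ∖ A)
    measurable-∖ mB mA = measurable-∁ (measurable-∪ (measurable-∁ mB) mA)

    ∖⊆ : B ∖ A ⊆ B
    ∖⊆ {B} {A} {ω} n with lem {B ω}
    ... | yes b = b
    ... | no ¬b = contradiction (inj₁ ¬b) n

    ⊥-∖ : A ⊥ B ∖ A
    ⊥-∖ (a , n) = n (inj₂ a)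

    ∪⊆∪∖ : A ∪ B ⊆ A ∪ (B ∖ A)
    ∪⊆∪∖             (inj₁ a) = inj₁ a
    ∪⊆∪∖ {A} {x = ω} (inj₂ b) with lem {A ω}
    ... | yes a = inj₁ a
    ... | no ¬a = inj₂ [ (λ ¬b → ¬b b) , ¬a ]′

    Pr-mono : (mA : Measurable A) (mB : Measurable B) → A ⊆ B → Pr A mA ≤ Pr B mB
    Pr-mono {A} {B} mA mB A⊆B = begin
      Pr A mA                                ≤⟨ x≤x+y _ (Pr-nonNegative _) ⟩
      Pr A mA + Pr (B ∖ A) (measurable-∖ mB mA) ≤⟨ Pr-⊎-≥ mA _ m∪ (⊥-∖ {A} {B}) ⟩
      Pr (A ∪ (B ∖ A)) m∪                    ≈⟨ Pr-cong m∪ mB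
        ([ A⊆B , ∖⊆ {B} {A} ]′ , λ b → ∪⊆∪∖ {A} {B} (inj₂ b)) ⟩
      Pr B mB                                ∎
      where
      m∪ : Measurable (A ∪ (B ∖ A))
      m∪ = measurable-∪ mA (measurable-∖ mB mA)

    Pr≤1 : (mA : Measurable A) → Pr A mA ≤ 1#
    Pr≤1 mA = ≤-trans (Pr-mono mA measurable-U (λ _ → tt)) (≤-reflexive Pr-U)

    Pr-∪-≤ : (mA : Measurable A) (mB : Measurable B) (m∪ : Measurable (A ∪ B)) →
             Pr (A ∪ B) m∪ ≤ Pr A mA + Pr B mB
    Pr-∪-≤ {A} {B} mA mB m∪ = begin
      Pr (A ∪ B) m∪                              ≤⟨ Pr-mono m∪ m∪∖ (∪⊆∪∖ {A} {B}) ⟩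
      Pr (A ∪ (B ∖ A)) m∪∖                       ≤⟨ Pr-⊎-≤ mA (measurable-∖ mB mA) m∪∖ (⊥-∖ {A} {B}) ⟩
      Pr A mA + Pr (B ∖ A) (measurable-∖ mB mA)  ≤⟨ +-monoʳ-≤ _ (Pr-mono _ mB (∖⊆ {B} {A})) ⟩
      Pr A mA + Pr B mB                          ∎
      where
      m∪∖ : Measurable (A ∪ (B ∖ A))
      m∪∖ = measurable-∪ mA (measurable-∖ mB mA)

  module _ {𝓟 : ProbabilitySpace} where
    open ProbabilitySpace 𝓟

    Pr>-anti : ∀ (X : RealVariable 𝓟) {r s} → r ≤ s → Pr[ X > s ] ≤ Pr[ X > r ]
    Pr>-anti X r≤s = Pr-mono 𝓟 _ _ (≤-<-trans r≤s)

    Pr-⊔ᵛ : ∀ (X Y : RealVariable 𝓟) r → Pr[ X ⊔ᵛ Y > r ] ≤ Pr[ X > r ] + Pr[ Y > r ]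
    Pr-⊔ᵛ X Y r = ≤-trans (Pr-mono 𝓟 _ m∪ ⊔⇒∪) (Pr-∪-≤ 𝓟 _ _ m∪)
      where
      module X = RealVariable X
      module Y = RealVariable Y
      m∪ : Measurable ((λ ω → r < X.value ω) ∪ (λ ω → r < Y.value ω))
      m∪ = measurable-∪ (X.measurable r) (Y.measurable r)
      ⊔⇒∪ : ∀ {ω} → r < X.value ω ⊔ Y.value ω → r < X.value ω ⊎ r < Y.value ω
      ⊔⇒∪ {ω} r<x⊔y with ⊔-sel (X.value ω) (Y.value ω)
      ... | inj₁ eq = inj₁ (<-respʳ-≈ eq r<x⊔y)
      ... | inj₂ eq = inj₂ (<-respʳ-≈ eq r<x⊔y)

    -- Iterated union bound. Only the marginal tails enter, so it applies to an arbitrary coupling.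
    Pr-maxᵛ : ∀ {A : Set} {n} (f : A → ℝ) (ys : Vec A (suc n)) (Xs : Vec (RealVariable 𝓟) (suc n)) r →
              (∀ i → Pr[ lookup Xs i > r ] ≤ f (lookup ys i)) →
              Pr[ maxᵛ Xs > r ] ≤ sum (Vec.map f ys)
    Pr-maxᵛ f (y ∷ [])      (X ∷ [])      r Pr≤f = ≤-trans (Pr≤f zero) (x≤x+y (f y) ≤-refl)
    Pr-maxᵛ f (y ∷ y′ ∷ ys) (X ∷ X′ ∷ Xs) r Pr≤f =
      ≤-trans (Pr-⊔ᵛ X (maxᵛ (X′ ∷ Xs)) r)
              (+-mono-≤ (Pr≤f zero) (Pr-maxᵛ f (y′ ∷ ys) (X′ ∷ Xs) r (λ i → Pr≤f (suc i))))

  -- Expectations of discrete variables.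

  module _ {𝓟 : ProbabilitySpace} {A : Set} (X : DiscreteVariable 𝓟 A) where
    open ProbabilitySpace 𝓟
    open DiscreteVariable X

    measurable-∈ : ∀ as → Measurable (λ ω → value ω ∈ as)
    measurable-∈ []       = measurable-resp-≐ ((λ n → contradiction tt n) , λ ()) (measurable-∁ measurable-U)
    measurable-∈ (a ∷ as) = measurable-resp-≐
      ([ here , there ]′ , λ { (here v≡a) → inj₁ v≡a ; (there v∈as) → inj₂ v∈as })
      (measurable-∪ (measurable a) (measurable-∈ as))

    -- Distinct values give disjoint events. Hence point masses sum to at most 1, the source of
    -- every bound on the partial sums of an expectation.
    sum-Pr≤Pr-∈ : ∀ as → Unique as → sumOver Pr[ X ≡_] as ≤ Pr (λ ω → value ω ∈ as) (measurable-∈ as)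
    sum-Pr≤Pr-∈ []       []              = Pr-nonNegative _
    sum-Pr≤Pr-∈ (a ∷ as) (a≢as ∷ unique) = begin
      Pr[ X ≡ a ] + sumOver Pr[ X ≡_] as                              ≤⟨ +-monoʳ-≤ _ (sum-Pr≤Pr-∈ as unique) ⟩
      Pr[ X ≡ a ] + Pr (λ ω → value ω ∈ as) (measurable-∈ as)         ≤⟨ Pr-⊎-≥ 𝓟 _ _ m∪ disjoint ⟩
      Pr ((λ ω → value ω ≡ a) ∪ (λ ω → value ω ∈ as)) m∪              ≤⟨ Pr-mono 𝓟 _ _ [ here , there ]′ ⟩
      Pr (λ ω → value ω ∈ a ∷ as) (measurable-∈ (a ∷ as))             ∎
      where
      m∪ : Measurable ((λ ω → value ω ≡ a) ∪ (λ ω → value ω ∈ as))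
      m∪ = measurable-∪ (measurable a) (measurable-∈ as)
      disjoint : (λ ω → value ω ≡ a) ⊥ (λ ω → value ω ∈ as)
      disjoint (v≡a , v∈as) = All.lookup a≢as v∈as (≡.sym v≡a)

    private
      variable
        φ ψ : A → ℝ
        b c : ℝ

    -- Off the support the weight vanishes and both sides are 0, so inequalities need only be known
    -- on the support.
    support-*-≤ : (∀ a → a ∈Support X → φ a ≤ ψ a) → ∀ a → Pr[ X ≡ a ] * φ a ≤ Pr[ X ≡ a ] * ψ a
    support-*-≤ {φ} {ψ} φ≤ψ a with Pr[ X ≡ a ] ≤? 0#
    ... | no  p≰0 = *-monoʳ-≤ (Pr-nonNegative _) (φ≤ψ a (≰⇒> p≰0))
    ... | yes p≤0 = begin
      Pr[ X ≡ a ] * φ a  ≈⟨ *-congʳ p≈0 ⟩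
      0# * φ a           ≈⟨ ≈-trans (zeroˡ _) (≈-sym (zeroˡ _)) ⟩
      0# * ψ a           ≈⟨ *-congʳ p≈0 ⟨
      Pr[ X ≡ a ] * ψ a  ∎
      where
      p≈0 : Pr[ X ≡ a ] ≈ 0#
      p≈0 = antisym p≤0 (Pr-nonNegative _)

    𝔼-partialSums≤ : 0# ≤ b → (∀ a → a ∈Support X → φ a ≤ b) →
                     PartialSums≤ (λ a → Pr[ X ≡ a ] * φ a) b
    𝔼-partialSums≤ {b} {φ} 0≤b φ≤b as unique = begin
      sumOver (λ a → Pr[ X ≡ a ] * φ a) as  ≤⟨ sumOver-mono (support-*-≤ φ≤b) as ⟩
      sumOver (λ a → Pr[ X ≡ a ] * b) as    ≤⟨ sumOver-mono (λ a → ≤-reflexive (*-comm _ b)) as ⟩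
      sumOver (λ a → b * Pr[ X ≡ a ]) as    ≈⟨ sumOver-* b _ as ⟩
      b * sumOver Pr[ X ≡_] as              ≤⟨ *-monoʳ-≤ 0≤b (≤-trans (sum-Pr≤Pr-∈ as unique) (Pr≤1 𝓟 _)) ⟩
      b * 1#                                ≈⟨ *-identityʳ b ⟩
      b                                     ∎

    𝔼≤ : 0# ≤ b → (∀ a → a ∈Support X → φ a ≤ b) → 𝔼[ φ ∘ X ] ≤ b
    𝔼≤ 0≤b φ≤b = ∑≤ (𝔼-partialSums≤ 0≤b φ≤b)

    𝔼-nonNegative : 0# ≤ b → (∀ a → a ∈Support X → φ a ≤ b) → 0# ≤ 𝔼[ φ ∘ X ]
    𝔼-nonNegative 0≤b φ≤b = partialSum≤∑ (𝔼-partialSums≤ 0≤b φ≤b) [] []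

    -- The single term at a is itself a finite partial sum, hence at most the expectation; dividing
    -- by its positive weight leaves φ a.
    𝔼≈0⇒support≈0 : 0# ≤ b → (∀ a → a ∈Support X → φ a ≤ b) → 𝔼[ φ ∘ X ] ≈ 0# →
                    ∀ a → a ∈Support X → φ a ≤ 0#
    𝔼≈0⇒support≈0 {b} {φ} 0≤b φ≤b 𝔼≈0 a 0<p = begin
      φ a                             ≈⟨ x*y⁻¹*y≈x (φ a) 0<p ⟨
      φ a * p ⁻¹ * p                  ≈⟨ *-assoc (φ a) (p ⁻¹) p ⟩
      φ a * (p ⁻¹ * p)                ≈⟨ *-comm (φ a) _ ⟩
      p ⁻¹ * p * φ a                  ≈⟨ *-assoc (p ⁻¹) p (φ a) ⟩
      p ⁻¹ * (p * φ a)                ≤⟨ *-monoʳ-≤ (x⁻¹-nonNegative 0<p) pφ≤0 ⟩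
      p ⁻¹ * 0#                       ≈⟨ zeroʳ (p ⁻¹) ⟩
      0#                              ∎
      where
      p : ℝ
      p = Pr[ X ≡ a ]
      pφ≤0 : p * φ a ≤ 0#
      pφ≤0 = begin
        p * φ a       ≤⟨ x≤x+y _ ≤-refl ⟩
        p * φ a + 0#  ≤⟨ partialSum≤∑ (𝔼-partialSums≤ 0≤b φ≤b) (a ∷ []) ([] ∷ []) ⟩
        𝔼[ φ ∘ X ]    ≈⟨ 𝔼≈0 ⟩
        0#            ∎

    𝔼-scaled-mono : 0# ≤ c → 0# ≤ b → (∀ a → a ∈Support X → ψ a ≤ b) →
                    (∀ a → a ∈Support X → φ a ≤ c * ψ a) → 𝔼[ φ ∘ X ] ≤ c * 𝔼[ ψ ∘ X ]
    𝔼-scaled-mono {c} {b} {ψ} {φ} 0≤c 0≤b ψ≤b φ≤cψ = ∑≤ λ as unique → begin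
      sumOver (λ a → Pr[ X ≡ a ] * φ a) as        ≤⟨ sumOver-mono (support-*-≤ φ≤cψ) as ⟩
      sumOver (λ a → Pr[ X ≡ a ] * (c * ψ a)) as  ≤⟨ sumOver-mono (λ a → ≤-reflexive (left-comm a)) as ⟩
      sumOver (λ a → c * (Pr[ X ≡ a ] * ψ a)) as  ≈⟨ sumOver-* c _ as ⟩
      c * sumOver (λ a → Pr[ X ≡ a ] * ψ a) as    ≤⟨ *-monoʳ-≤ 0≤c
        (partialSum≤∑ (𝔼-partialSums≤ 0≤b ψ≤b) as unique) ⟩
      c * 𝔼[ ψ ∘ X ]                              ∎
      where
      left-comm : ∀ a → Pr[ X ≡ a ] * (c * ψ a) ≈ c * (Pr[ X ≡ a ] * ψ a)
      left-comm a = begin-equality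
        Pr[ X ≡ a ] * (c * ψ a)  ≈⟨ *-assoc _ c (ψ a) ⟨
        Pr[ X ≡ a ] * c * ψ a    ≈⟨ *-congʳ (*-comm _ c) ⟩
        c * Pr[ X ≡ a ] * ψ a    ≈⟨ *-assoc c _ (ψ a) ⟩
        c * (Pr[ X ≡ a ] * ψ a)  ∎

  module _ {A : Set} (f : A → ℝ) where

    lookup≤maximum : ∀ {n} (ys : Vec A (suc n)) i → f (lookup ys i) ≤ maximum (Vec.map f ys)
    lookup≤maximum (y ∷ [])      zero    = ≤-refl
    lookup≤maximum (y ∷ y′ ∷ ys) zero    = x≤x⊔y _ _
    lookup≤maximum (y ∷ y′ ∷ ys) (suc i) = ≤-trans (lookup≤maximum (y′ ∷ ys) i) (x≤y⊔x (f y) _)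

    maximum≤ : ∀ {n b} (ys : Vec A (suc n)) → (∀ i → f (lookup ys i) ≤ b) → maximum (Vec.map f ys) ≤ b
    maximum≤ (y ∷ [])      f≤b = f≤b zero
    maximum≤ (y ∷ y′ ∷ ys) f≤b = ⊔-lub (f≤b zero) (maximum≤ (y′ ∷ ys) (λ i → f≤b (suc i)))

    sum-*ʳ : ∀ {n} c (ys : Vec A n) → sum (Vec.map (λ y → f y * c) ys) ≈ sum (Vec.map f ys) * c
    sum-*ʳ c []       = ≈-sym (zeroˡ c)
    sum-*ʳ c (y ∷ ys) = ≈-trans (+-congˡ (sum-*ʳ c ys)) (≈-sym (distribʳ c (f y) _))

  -- Nested splittings.

  module _ {I : Set} {n : ℕ} (size : I → ℝ) {𝓟 : I → ProbabilitySpace}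
           (h : ∀ z → DiscreteVariable (𝓟 z) (Vec I n)) (c : ℝ) where

    Pr-nested>≤1 : ∀ {k} (is : Vec (Fin n) k) z → Pr-nested> size h c is z ≤ 1#
    Pr-nested>≤1 [] z with size z ≤? c
    ... | yes _ = 0≤1
    ... | no  _ = ≤-refl
    Pr-nested>≤1 (i ∷ is) z = 𝔼≤ (h z) 0≤1 (λ y _ → Pr-nested>≤1 is (lookup y i))

    Pr-nested>-nonNegative : ∀ {k} (is : Vec (Fin n) k) z → 0# ≤ Pr-nested> size h c is z
    Pr-nested>-nonNegative [] z with size z ≤? c
    ... | yes _ = ≤-refl
    ... | no  _ = 0≤1
    Pr-nested>-nonNegative (i ∷ is) z = 𝔼-nonNegative (h z) 0≤1 (λ y _ → Pr-nested>≤1 is (lookup y i))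

    Pr-nested>≈0-base : ∀ z → Pr-nested> size h c [] z ≈ 0# → size z ≤ c
    Pr-nested>≈0-base z ≈0 with size z ≤? c
    ... | yes z≤c = z≤c
    ... | no  _   = contradiction (≈-sym ≈0) 0≉1

    -- Turns the probabilistic termination assumption into a descent along values of positive
    -- probability: each of them inherits it for a word shorter by one letter.
    Pr-nested>≈0-step : ∀ {k} i (is : Vec (Fin n) k) z → Pr-nested> size h c (i ∷ is) z ≈ 0# →
                        ∀ y → y ∈Support h z → Pr-nested> size h c is (lookup y i) ≈ 0#
    Pr-nested>≈0-step i is z ≈0 y y∈h = antisym
      (𝔼≈0⇒support≈0 (h z) 0≤1 (λ y _ → Pr-nested>≤1 is (lookup y i)) ≈0 y y∈h)
      (Pr-nested>-nonNegative is (lookup y i))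

-- Levels and monotonicity of the slope.

module RecurrenceBound (lem : ExcludedMiddle 0ℓ) (R : CompleteOrderedField) where

  open CompleteOrderedField R
  open RealProperties R
  open Probability lem R
  open ProbabilityProperties lem R

  module Solution
    (d : ℝ) (0≤d : 0# ≤ d)
    (a : ℝ → ℝ) (a-positive : ∀ x → d < x → 0# < a x)
    (a-mono : MonotoneOn ⟨ d ,∞⟩ a) (a-continuous : ContinuousOn ⟨ d ,∞⟩ a)
    (m : ℝ → ℝ) (m-bounds : ∀ x → 0# ≤ x → 0# ≤ m x × m x ≤ x)
    (ratio-mono : MonotoneOn ⟨ 0# ,∞⟩ (λ x → m x / x))
    (u : ℝ → ℝ) (u-mono : u Preserves _≤_ ⟶ _≤_) (u-continuous : ContinuousOn ⟨ d ,∞⟩ u)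
    (u-recurrence : ∀ x → 0# ≤ x → a x + u (m x) ≤ u x)
    (u-flat : ∀ x → x ≤ d → u x ≈ u d)
    (u′ : ℝ → ℝ) (u′-cong : u′ Preserves _≈_ ⟶ _≈_)
    (u′∘u : ∀ x → d < x → u′ (u x) ≈ x)
    (u∘u′ : ∀ y → u d < y → u (u′ y) ≈ y)
    where

    private
      variable
        r x y : ℝ
        j k : ℕ

    0<x : d < x → 0# < x
    0<x = ≤-<-trans 0≤d

    0≤x : d < x → 0# ≤ x
    0≤x d<x = <⇒≤ (0<x d<x)

    0≤a : d < x → 0# ≤ a x
    0≤a {x} d<x = <⇒≤ (a-positive x d<x)

    ratio-nonNegative : d < x → 0# ≤ m x / x
    ratio-nonNegative {x} d<x =
      *-nonNegative (proj₁ (m-bounds x (0≤x d<x))) (x⁻¹-nonNegative (0<x d<x))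

    u[d]≤u[m] : ∀ x → u d ≤ u (m x)
    u[d]≤u[m] x with total d (m x)
    ... | inj₁ d≤mx = u-mono d≤mx
    ... | inj₂ mx≤d = ≤-reflexive (≈-sym (u-flat (m x) mx≤d))

    -- Makes the denominators in `D` positive.
    d<u′ : u d < y → d < u′ y
    d<u′ {y} ud<y = ≰⇒> λ u′y≤d → <⇒≱ ud<y (begin
      y         ≈⟨ u∘u′ y ud<y ⟨
      u (u′ y)  ≤⟨ u-mono u′y≤d ⟩
      u d       ∎)

    u′-mono : u d < x → x ≤ y → u′ x ≤ u′ y
    u′-mono {x} {y} ud<x x≤y = ≮⇒≥ λ u′y<u′x → proj₂ u′y<u′x (u′-cong (antisym (begin
      y         ≈⟨ u∘u′ y (<-≤-trans ud<x x≤y) ⟨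
      u (u′ y)  ≤⟨ u-mono (<⇒≤ u′y<u′x) ⟩
      u (u′ x)  ≈⟨ u∘u′ x ud<x ⟩
      x         ∎) x≤y))

    -- If u′ y < x, monotonicity squeezes u x to y, and then x = u′ (u x) = u′ y. Points up to d,
    -- where `u` is not inverted, are covered by `d<u′`.
    u[x]≤y⇒x≤u′y : u d < y → u x ≤ y → x ≤ u′ y
    u[x]≤y⇒x≤u′y {y} {x} ud<y ux≤y with total x d
    ... | inj₁ x≤d = ≤-trans x≤d (<⇒≤ (d<u′ ud<y))
    ... | inj₂ d≤x = ≮⇒≥ λ u′y<x → <-irrefl (begin-equality
      u′ y  ≈⟨ u′-cong (antisym (begin
                 y         ≈⟨ u∘u′ y ud<y ⟨
                 u (u′ y)  ≤⟨ u-mono (<⇒≤ u′y<x) ⟩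
                 u x       ∎) ux≤y) ⟩
      u′ (u x)  ≈⟨ u′∘u x (<-trans (d<u′ ud<y) u′y<x) ⟩
      x     ∎) u′y<x

    residual : ℝ → ℕ → ℝ → ℝ
    residual r k x = r - a x * (k · 1#)

    residual+k·a≈r : ∀ r k x → residual r k x + k · a x ≈ r
    residual+k·a≈r r k x = begin-equality
      residual r k x + k · a x            ≈⟨ +-congˡ (x*k·1≈k·x k (a x)) ⟨
      residual r k x + a x * (k · 1#)     ≈⟨ x-y+y≈x r _ ⟩
      r                                   ∎

    -- For x > d, this says k = ⌈(r - u x) / a x⌉ (and k = 0 if r ≤ u x).
    Level : ℝ → ℕ → ℝ → Set
    Level r k x = r ≤ u x + k · a x × (∀ j → j ℕ.< k → u x + j · a x < r)

    -- D_r(x) / x in terms of the level k.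
    slope : ℝ → ℕ → ℝ → ℝ
    slope r k x = (m x / x) ^ k * u′ (residual r k x) ⁻¹

    level-zero : r ≤ u x → Level r 0 x
    level-zero {r} {x} r≤ux = ≤-trans r≤ux (x≤x+y (u x) ≤-refl) , λ _ ()

    level-⌈⌉ : d < x → Level r ⌈ (r - u x) / a x ⌉ x
    level-⌈⌉ {x} {r} d<x = r≤ , λ j j<k → ≰⇒> λ r≤ux+ja → ℕ.<⇒≱ j<k (proj₂ spec j (above j r≤ux+ja))
      where
      q : ℝ
      q = (r - u x) / a x
      spec : q ≤ ⌈ q ⌉ · 1# × (∀ j → q ≤ j · 1# → ⌈ q ⌉ ℕ.≤ j)
      spec = ⌈⌉-spec q
      scale : ∀ k → k · 1# * a x ≈ k · a x
      scale k = ≈-trans (*-comm _ _) (x*k·1≈k·x k (a x))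
      r≤ : r ≤ u x + ⌈ q ⌉ · a x
      r≤ = begin
        r                         ≈⟨ x-y+y≈x r (u x) ⟨
        r - u x + u x             ≤⟨ +-monoˡ-≤ (u x) (/≤⇒≤* (a-positive x d<x) (proj₁ spec)) ⟩
        ⌈ q ⌉ · 1# * a x + u x    ≈⟨ +-congʳ (scale ⌈ q ⌉) ⟩
        ⌈ q ⌉ · a x + u x         ≈⟨ +-comm _ (u x) ⟩
        u x + ⌈ q ⌉ · a x         ∎
      above : ∀ j → r ≤ u x + j · a x → q ≤ j · 1#
      above j r≤ux+ja = ≤*⇒/≤ (a-positive x d<x) (+-cancelʳ-≤ (u x) (begin
        r - u x + u x       ≈⟨ x-y+y≈x r (u x) ⟩
        r                   ≤⟨ r≤ux+ja ⟩
        u x + j · a x       ≈⟨ +-comm (u x) _ ⟩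
        j · a x + u x       ≈⟨ +-congʳ (scale j) ⟨
        j · 1# * a x + u x  ∎))

    -- For k = suc j, minimality of the level says that j steps do not yet reach r; by the
    -- recurrence for `u`, the one further step leaves a residual above u (m x).
    u[d]<residual : u d < r → d < x → ∀ k → Level r k x → u d < residual r k x
    u[d]<residual {r} {x} ud<r d<x zero _ = <-respʳ-≈ (≈-sym (begin-equality
      residual r 0 x       ≈⟨ +-identityʳ _ ⟨
      residual r 0 x + 0#  ≈⟨ residual+k·a≈r r 0 x ⟩
      r                    ∎)) ud<r
    u[d]<residual {r} {x} ud<r d<x (suc j) (_ , below) = ≤-<-trans (u[d]≤u[m] x)
      (+-cancelʳ-< (suc j · a x) (begin-strict
        u (m x) + (a x + j · a x)         ≈⟨ +-assoc (u (m x)) (a x) _ ⟨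
        u (m x) + a x + j · a x           ≈⟨ +-congʳ (+-comm _ (a x)) ⟩
        a x + u (m x) + j · a x           ≤⟨ +-monoˡ-≤ _ (u-recurrence x (0≤x d<x)) ⟩
        u x + j · a x                     <⟨ below j ℕ.≤-refl ⟩
        r                                 ≈⟨ residual+k·a≈r r (suc j) x ⟨
        residual r (suc j) x + suc j · a x ∎))

    slope-nonNegative : u d < r → d < x → Level r k x → 0# ≤ slope r k x
    slope-nonNegative {k = k} ud<r d<x lev = *-nonNegative
      (^-nonNegative k (ratio-nonNegative d<x))
      (x⁻¹-nonNegative (0<x (d<u′ (u[d]<residual ud<r d<x k lev))))

    u+k·a-mono : ∀ k → MonotoneOn ⟨ d ,∞⟩ (λ x → u x + k · a x)
    u+k·a-mono k x y d<x d<y x≤y = +-mono-≤ (u-mono x≤y) (·-monoʳ-≤ k (a-mono x y d<x d<y x≤y))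

    level-antitone : d < y → y ≤ x → Level r k y → Level r j x → j ℕ.≤ k
    level-antitone {y} {x} {r} {k} d<y y≤x (r≤ , _) (_ , below) = ℕ.≮⇒≥ λ k<j →
      <⇒≱ (below k k<j) (≤-trans r≤ (u+k·a-mono k y x d<y (<-≤-trans d<y y≤x) y≤x))

    ratio^-mono : ∀ k → d < y → y ≤ x → (m y / y) ^ k ≤ (m x / x) ^ k
    ratio^-mono k d<y y≤x = ^-monoˡ-≤ k (ratio-nonNegative d<y)
      (ratio-mono _ _ (0<x d<y) (<-≤-trans (0<x d<y) y≤x) y≤x)

    -- Both factors grow: the ratio m x / x by assumption, and the reciprocal because a larger a x
    -- lowers the residual and with it the value of `u′`.
    slope-mono-level : u d < r → d < y → y ≤ x → ∀ k → Level r k y → Level r k x →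
                       slope r k y ≤ slope r k x
    slope-mono-level {r} {y} {x} ud<r d<y y≤x k lev-y lev-x = *-mono-≤
      (^-nonNegative k (ratio-nonNegative d<y))
      (x⁻¹-nonNegative (0<x (d<u′ ud<residual-x)))
      (ratio^-mono k d<y y≤x)
      (⁻¹-anti-≤ (0<x (d<u′ ud<residual-x)) (u′-mono ud<residual-x (+-cancelʳ-≤ (k · a y) (begin
        residual r k x + k · a y  ≤⟨ +-monoʳ-≤ _ (·-monoʳ-≤ k (a-mono y x d<y d<x y≤x)) ⟩
        residual r k x + k · a x  ≈⟨ residual+k·a≈r r k x ⟩
        r                         ≈⟨ residual+k·a≈r r k y ⟨
        residual r k y + k · a y  ∎))))
      where
      d<x : d < x
      d<x = <-≤-trans d<y y≤x
      ud<residual-x : u d < residual r k x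
      ud<residual-x = u[d]<residual ud<r d<x k lev-x

    -- At a point x where the level is about to drop, the recurrence for u
    -- gives m x ≤ u′ (residual), which pays for the lost factor m x / x.
    slope-jump : u d < r → d < y → y ≤ x → ∀ k → Level r (suc k) y → u x + k · a x ≈ r →
                 slope r (suc k) y ≤ slope r k x
    slope-jump {r} {y} {x} ud<r d<y y≤x k lev ux+ka≈r = begin
      (m y / y) ^ suc k * w            ≤⟨ *-monoˡ-≤ 0≤w (ratio^-mono (suc k) d<y y≤x) ⟩
      m x / x * (m x / x) ^ k * w      ≈⟨ *-congʳ (*-comm _ _) ⟩
      (m x / x) ^ k * (m x / x) * w    ≈⟨ *-assoc _ _ w ⟩
      (m x / x) ^ k * (m x / x * w)    ≈⟨ *-congˡ (*-congʳ (*-comm _ _)) ⟩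
      (m x / x) ^ k * (x ⁻¹ * m x * w) ≈⟨ *-congˡ (*-assoc _ _ w) ⟩
      (m x / x) ^ k * (x ⁻¹ * (m x / u′ v)) ≤⟨ *-monoʳ-≤ (^-nonNegative k (ratio-nonNegative d<x))
        (*-monoʳ-≤ (x⁻¹-nonNegative (0<x d<x)) (≤⇒/≤1 (0<x d<u′v) (u[x]≤y⇒x≤u′y ud<v u[mx]≤v))) ⟩
      (m x / x) ^ k * (x ⁻¹ * 1#)      ≈⟨ *-congˡ (*-identityʳ _) ⟩
      (m x / x) ^ k * x ⁻¹             ≈⟨ *-congˡ (⁻¹-cong (begin-equality
        u′ (residual r k x)  ≈⟨ u′-cong residual≈ux ⟩
        u′ (u x)             ≈⟨ u′∘u x d<x ⟩
        x                    ∎)) ⟨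
      slope r k x                      ∎
      where
      v w : ℝ
      v = residual r (suc k) y
      w = u′ v ⁻¹
      d<x : d < x
      d<x = <-≤-trans d<y y≤x
      ud<v : u d < v
      ud<v = u[d]<residual ud<r d<y (suc k) lev
      d<u′v : d < u′ v
      d<u′v = d<u′ ud<v
      0≤w : 0# ≤ w
      0≤w = x⁻¹-nonNegative (0<x d<u′v)
      u[mx]≤v : u (m x) ≤ v
      u[mx]≤v = +-cancelʳ-≤ (suc k · a x) (begin
        u (m x) + (a x + k · a x)  ≈⟨ +-assoc (u (m x)) (a x) _ ⟨
        u (m x) + a x + k · a x    ≈⟨ +-congʳ (+-comm _ (a x)) ⟩
        a x + u (m x) + k · a x    ≤⟨ +-monoˡ-≤ _ (u-recurrence x (0≤x d<x)) ⟩
        u x + k · a x              ≈⟨ ux+ka≈r ⟩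
        r                          ≈⟨ residual+k·a≈r r (suc k) y ⟨
        v + suc k · a y            ≤⟨ +-monoʳ-≤ v (·-monoʳ-≤ (suc k) (a-mono y x d<y d<x y≤x)) ⟩
        v + suc k · a x            ∎)
      residual≈ux : residual r k x ≈ u x
      residual≈ux = begin-equality
        residual r k x                        ≈⟨ x+y-y≈x _ (k · a x) ⟨
        residual r k x + k · a x - k · a x    ≈⟨ +-congʳ (≈-trans (residual+k·a≈r r k x) (≈-sym ux+ka≈r)) ⟩
        u x + k · a x - k · a x               ≈⟨ x+y-y≈x (u x) _ ⟩
        u x                                   ∎

    -- Recursion on the level at the left end: each crossing point found replaces the left end and
    -- lowers its level by one, until the levels at both ends agree.
    slope-mono : u d < r → d < y → y ≤ x → ∀ k → Level r k y → Level r j x →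
                 slope r k y ≤ slope r j x
    slope-mono {r} {y} {x} {j} ud<r d<y y≤x k lev-y lev-x =
      compare k lev-y (ℕ.m≤n⇒m<n∨m≡n (level-antitone d<y y≤x lev-y lev-x))
      where
      compare : ∀ k → Level r k y → j ℕ.< k ⊎ j ≡ k → slope r k y ≤ slope r j x
      compare k       lev-y           (inj₂ refl)          = slope-mono-level ud<r d<y y≤x k lev-y lev-x
      compare (suc k) lev-y@(_ , below) (inj₁ (ℕ.s≤s j≤k)) = through
        -- Minimality of the level suc k at y keeps u + k · a below r there; at x it has reached r,
        -- since level j suffices and j ≤ k.
        (intermediateValue (u+k·a-mono k) (continuousOn-+ u-continuous (continuousOn-· k a-continuous))
           d<y y≤x (<⇒≤ (below k ℕ.≤-refl))
           (≤-trans (proj₁ lev-x) (+-monoʳ-≤ (u x) (·-monoˡ-≤ (0≤a (<-≤-trans d<y y≤x)) j≤k))))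
        where
        through : ∃[ s ] y ≤ s × s ≤ x × u s + k · a s ≈ r → slope r (suc k) y ≤ slope r j x
        through (s , y≤s , s≤x , us+ka≈r) = ≤-trans
          (slope-jump ud<r d<y y≤s k lev-y us+ka≈r)
          (slope-mono ud<r d<s s≤x k (≤-reflexive (≈-sym us+ka≈r) , below-s) lev-x)
          where
          d<s : d < s
          d<s = <-≤-trans d<y y≤s
          below-s : ∀ i → i ℕ.< k → u s + i · a s < r
          below-s i (ℕ.s≤s {n = k′} i≤k′) = begin-strict
            u s + i · a s            ≤⟨ +-monoʳ-≤ (u s) (·-monoˡ-≤ (0≤a d<s) i≤k′) ⟩
            u s + k′ · a s           <⟨ x<x+y _ (a-positive s d<s) ⟩
            u s + k′ · a s + a s     ≈⟨ +-assoc (u s) _ (a s) ⟩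
            u s + (k′ · a s + a s)   ≈⟨ +-congˡ (+-comm _ (a s)) ⟩
            u s + suc k′ · a s       ≈⟨ us+ka≈r ⟩
            r                        ∎

    -- Evaluation of `D` and its linear majorant.

    D-base : ∀ {r x} → r ≤ u d → D d a m u u′ r x ≡ 1#
    D-base {r} r≤ud rewrite dec-true (r ≤? u d) r≤ud = refl

    D-small : ∀ {r x} → u d < r → x ≤ d → D d a m u u′ r x ≡ 0#
    D-small {r} {x} ud<r x≤d
      rewrite dec-false (r ≤? u d) (<⇒≱ ud<r) | dec-true (x ≤? d) x≤d = refl

    D-certain : ∀ {r x} → d < x → r ≤ u x → D d a m u u′ r x ≡ 1#
    D-certain {r} {x} d<x r≤ux with r ≤? u d
    ... | yes _ = refl
    ... | no  _ rewrite dec-false (x ≤? d) (<⇒≱ d<x) | dec-true (r ≤? u x) r≤ux = refl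

    D-formula : ∀ {r x} → u d < r → d < x → u x < r →
                let k = ⌈ (r - u x) / a x ⌉ in
                D d a m u u′ r x ≡ (m x / x) ^ k * (x / u′ (residual r k x))
    D-formula {r} {x} ud<r d<x ux<r
      rewrite dec-false (r ≤? u d) (<⇒≱ ud<r) | dec-false (x ≤? d) (<⇒≱ d<x)
            | dec-false (r ≤? u x) (<⇒≱ ux<r) = refl

    slope*x≈D : ∀ r k x → (m x / x) ^ k * (x / u′ (residual r k x)) ≈ slope r k x * x
    slope*x≈D r k x = ≈-trans (*-congˡ (*-comm x _)) (≈-sym (*-assoc _ _ x))

    -- Where `D` is cut off at 1, level 0 still works: r ≤ u y gives u′ r ≤ y, so the slope at level
    -- 0 times y is at least 1.
    D≤slope*y : u d < r → d < y → y ≤ x → Level r j x → D d a m u u′ r y ≤ slope r j x * y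
    D≤slope*y {r} {y} {x} {j} ud<r d<y y≤x lev = cases (r ≤? u y)
      where
      u′residual≤y : r ≤ u y → u′ (residual r 0 y) ≤ y
      u′residual≤y r≤uy = begin
        u′ (residual r 0 y)     ≤⟨ u′-mono (u[d]<residual ud<r d<y 0 (level-zero r≤uy)) (begin
          residual r 0 y          ≈⟨ +-identityʳ _ ⟨
          residual r 0 y + 0#     ≈⟨ residual+k·a≈r r 0 y ⟩
          r                       ≤⟨ r≤uy ⟩
          u y                     ∎) ⟩
        u′ (u y)                ≈⟨ u′∘u y d<y ⟩
        y                       ∎
      n : ℕ
      n = ⌈ (r - u y) / a y ⌉
      cases : Dec (r ≤ u y) → D d a m u u′ r y ≤ slope r j x * y
      cases (yes r≤uy) = begin
        D d a m u u′ r y                ≡⟨ D-certain d<y r≤uy ⟩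
        1#                              ≤⟨ ≤⇒1≤/
          (0<x (d<u′ (u[d]<residual ud<r d<y 0 (level-zero r≤uy)))) (u′residual≤y r≤uy) ⟩
        y / u′ (residual r 0 y)         ≈⟨ *-identityˡ _ ⟨
        1# * (y / u′ (residual r 0 y))  ≈⟨ slope*x≈D r 0 y ⟩
        slope r 0 y * y                 ≤⟨ *-monoˡ-≤ (0≤x d<y) (slope-mono ud<r d<y y≤x 0 (level-zero r≤uy) lev) ⟩
        slope r j x * y                 ∎
      cases (no r≰uy) = begin
        D d a m u u′ r y                           ≡⟨ D-formula ud<r d<y (≰⇒> r≰uy) ⟩
        (m y / y) ^ n * (y / u′ (residual r n y))  ≈⟨ slope*x≈D r n y ⟩
        slope r n y * y                            ≤⟨ *-monoˡ-≤ (0≤x d<y)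
          (slope-mono ud<r d<y y≤x n (level-⌈⌉ d<y) lev) ⟩
        slope r j x * y                            ∎

    -- The field `u[d]<r-a` is there for the parts of size at most d: their tails vanish beyond the
    -- lowered threshold.
    record LinearMajorant (r x : ℝ) : Set where
      field
        c              : ℝ
        c-nonNegative  : 0# ≤ c
        u[d]<r-a       : u d < r - a x
        D≤c*y          : ∀ y → d < y → y ≤ x → D d a m u u′ (r - a x) y ≤ c * y
        c*m≈D          : c * m x ≈ D d a m u u′ r x

    -- Lowering the threshold by a x lowers the level at x by exactly one and leaves the residual
    -- unchanged.
    linearMajorant : d < x → u d < r → u x < r → LinearMajorant r x
    linearMajorant {x} {r} d<x ud<r ux<r = build ⌈ (r - u x) / a x ⌉ (level-⌈⌉ d<x)
      (≡.subst (_≈ D d a m u u′ r x) (D-formula ud<r d<x ux<r) ≈-refl)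
      where
      build : ∀ k → Level r k x → (m x / x) ^ k * (x / u′ (residual r k x)) ≈ D d a m u u′ r x →
              LinearMajorant r x
      -- Level 0 would mean r ≤ u x.
      build zero    (r≤ , _)     _        = contradiction
        (≤-trans r≤ (≤-reflexive (+-identityʳ (u x)))) (<⇒≱ ux<r)
      build (suc j) lev@(r≤ , below) formula = record
        { c             = c
        ; c-nonNegative = slope-nonNegative ud<r′ d<x lev′
        ; u[d]<r-a      = ud<r′
        ; D≤c*y         = λ y d<y y≤x → D≤slope*y ud<r′ d<y y≤x lev′
        -- Writing m x as ρ * x supplies the one factor ρ by which the two exponents differ.
        ; c*m≈D         = begin-equality
            c * m x                                          ≈⟨ *-congʳ (*-congˡ (⁻¹-cong (u′-cong residual-eq))) ⟩
            ρ ^ j * w * m x                                  ≈⟨ *-congˡ (x*y⁻¹*y≈x (m x) (0<x d<x)) ⟨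
            ρ ^ j * w * (ρ * x)                              ≈⟨ *-assoc _ w _ ⟩
            ρ ^ j * (w * (ρ * x))                            ≈⟨ *-congˡ (*-comm w _) ⟩
            ρ ^ j * (ρ * x * w)                              ≈⟨ *-congˡ (*-assoc ρ x w) ⟩
            ρ ^ j * (ρ * (x * w))                            ≈⟨ *-assoc _ ρ _ ⟨
            ρ ^ j * ρ * (x * w)                              ≈⟨ *-congʳ (*-comm _ ρ) ⟩
            ρ ^ suc j * (x * w)                              ≈⟨ formula ⟩
            D d a m u u′ r x                                 ∎
        }
        where
        r′ c ρ w : ℝ
        r′ = r - a x
        c  = slope r′ j x
        ρ  = m x / x
        w  = u′ (residual r (suc j) x) ⁻¹
        r′+a : ∀ k → u x + k · a x + a x ≈ u x + suc k · a x
        r′+a k = ≈-trans (+-assoc (u x) _ (a x)) (+-congˡ (+-comm _ (a x)))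
        lev′ : Level r′ j x
        lev′ = +-cancelʳ-≤ (a x) (begin
                 r′ + a x               ≈⟨ x-y+y≈x r (a x) ⟩
                 r                      ≤⟨ r≤ ⟩
                 u x + suc j · a x      ≈⟨ r′+a j ⟨
                 u x + j · a x + a x    ∎)
             , λ i i<j → +-cancelʳ-< (a x) (begin-strict
                 u x + i · a x + a x    ≈⟨ r′+a i ⟩
                 u x + suc i · a x      <⟨ below (suc i) (ℕ.s≤s i<j) ⟩
                 r                      ≈⟨ x-y+y≈x r (a x) ⟨
                 r′ + a x               ∎)
        residual-eq : residual r′ j x ≈ residual r (suc j) x
        residual-eq = antisym (+-cancelʳ-≤ (suc j · a x) (≤-reflexive both))
                              (+-cancelʳ-≤ (suc j · a x) (≤-reflexive (≈-sym both)))
          where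
          both : residual r′ j x + suc j · a x ≈ residual r (suc j) x + suc j · a x
          both = begin-equality
            residual r′ j x + (a x + j · a x)       ≈⟨ +-congˡ (+-comm (a x) _) ⟩
            residual r′ j x + (j · a x + a x)       ≈⟨ +-assoc _ _ (a x) ⟨
            residual r′ j x + j · a x + a x         ≈⟨ +-congʳ (residual+k·a≈r r′ j x) ⟩
            r - a x + a x                           ≈⟨ x-y+y≈x r (a x) ⟩
            r                                       ≈⟨ residual+k·a≈r r (suc j) x ⟨
            residual r (suc j) x + suc j · a x      ∎
        ud<r′ : u d < r′
        ud<r′ = ≤-<-trans (u[d]≤u[m] x) (+-cancelʳ-< (a x) (begin-strict
          u (m x) + a x    ≈⟨ +-comm _ (a x) ⟩
          a x + u (m x)    ≤⟨ u-recurrence x (0≤x d<x) ⟩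
          u x              <⟨ ux<r ⟩
          r                ≈⟨ x-y+y≈x r (a x) ⟨
          r′ + a x         ∎))

-- Induction on the depth of the splitting.

theorem6 :
  (lem : ExcludedMiddle 0ℓ) (R : CompleteOrderedField) →
  let open CompleteOrderedField R
      open Probability lem R
  in
  (I : Set) (size : I → ℝ) → (∀ z → 0# ≤ size z) →
  (n-1 : ℕ) → let n = suc n-1 in
  (d : ℝ) → 0# ≤ d →
  (Ωʰ : I → ProbabilitySpace) (h : ∀ z → DiscreteVariable (Ωʰ z) (Vec I n)) →
  (∀ z y → y ∈Support h z → ∀ i → size (lookup y i) ≤ size z) →
  (Ωˢ : I → ProbabilitySpace) (S : ∀ z → RealVariable (Ωˢ z)) →
  (a : ℝ → ℝ) →
  (∀ x → 0# ≤ x → x ≤ d → a x ≈ 0#) →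
  (∀ x → d < x → 0# < a x) →
  MonotoneOn ⟨ d ,∞⟩ a → ContinuousOn ⟨ d ,∞⟩ a →
  (copies : (z : I) (y : Vec I n) → Coupling (λ i → S (lookup y i))) →
  (∀ z → d < size z → ∀ r →
    Pr[ S z > r ] ≤
    (∑[ y ] (Pr[ h z ≡ y ]
             * Pr[ maxᵛ (Coupling.variables (copies z y)) > r - a (size z) ]))) →
  (∀ z → ∃[ k ] ((is : Vec (Fin n) k) → Pr-nested> size h d is z ≈ 0#)) →
  (m : ℝ → ℝ) →
  (∀ x → 0# ≤ x → 0# ≤ m x × m x ≤ x) →
  MonotoneOn ⟨ 0# ,∞⟩ (λ x → m x / x) →
  (∀ z → 𝔼[ (λ y → maximum (Vec.map size y)) ∘ h z ] ≤ m (size z)) →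
  (u : ℝ → ℝ) →
  u Preserves _≤_ ⟶ _≤_ → ContinuousOn ⟨ d ,∞⟩ u →
  (∀ x → 0# ≤ x → a x + u (m x) ≤ u x) →
  (∀ x → x ≤ d → u x ≈ u d) →
  (∀ z → size z ≤ d → Pr[ S z > u (size z) ] ≈ 0#) →
  (u′ : ℝ → ℝ) → u′ Preserves _≈_ ⟶ _≈_ → (∀ y → 0# ≤ u′ y) →
  (∀ x → d < x → u′ (u x) ≈ x) →
  (∀ y → u d < y → u (u′ y) ≈ y) →
  (g₁ : ℝ → ℝ) → (∀ x → 0# ≤ g₁ x) →
  g₁ Preserves _≤_ ⟶ _≤_ →
  (∀ x → d < x → 1# ≤ g₁ x) →
  (∀ z → d < size z → ∀ y → y ∈Support h z →
    sum (Vec.map (λ yᵢ → g₁ (size yᵢ)) y) ≤ g₁ (size z)) →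
  ∀ z r → 1# ≤ g₁ (size z) →
  Pr[ S z > r ] ≤ g₁ (size z) * D d a m u u′ r (size z)
theorem6 lem R I size 0≤size n-1 d 0≤d Ωʰ h h-shrinks Ωˢ S a a-zero a-positive a-mono a-continuous
         copies recurrence terminates m m-bounds ratio-mono 𝔼-size u u-mono u-continuous u-recurrence
         u-flat S-base u′ u′-cong u′-nonNegative u′∘u u∘u′ g₁ g₁-nonNegative g₁-mono g₁≥1 g₁-splits z r =
  bound (proj₁ (terminates z)) z (proj₂ (terminates z)) r
  where
  open CompleteOrderedField R
  open RealProperties R
  open Probability lem R
  open ProbabilityProperties lem R
  open RecurrenceBound lem R
  open Solution d 0≤d a a-positive a-mono a-continuous m m-bounds ratio-mono u u-mono u-continuous
                u-recurrence u-flat u′ u′-cong u′∘u u∘u′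

  𝓓 : ℝ → ℝ → ℝ
  𝓓 = D d a m u u′

  maxSize : Vec I (suc n-1) → ℝ
  maxSize y = maximum (Vec.map size y)

  Terminates : ℕ → I → Set
  Terminates k z = (is : Vec (Fin (suc n-1)) k) → Pr-nested> size h d is z ≈ 0#

  -- Free of `g₁`, so that it also serves parts whose weight is below 1.
  small : ∀ z r → size z ≤ d → u d < r → Pr[ S z > r ] ≤ 0#
  small z r z≤d ud<r = begin
    Pr[ S z > r ]           ≤⟨ Pr>-anti (S z) (≤-trans (≤-reflexive (u-flat (size z) z≤d)) (<⇒≤ ud<r)) ⟩
    Pr[ S z > u (size z) ]  ≈⟨ S-base z z≤d ⟩
    0#                      ∎

  certain : ∀ z r → 1# ≤ g₁ (size z) → 𝓓 r (size z) ≡ 1# → Pr[ S z > r ] ≤ g₁ (size z) * 𝓓 r (size z)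
  certain z r 1≤g D≡1 = begin
    Pr[ S z > r ]                ≤⟨ Pr≤1 (Ωˢ z) _ ⟩
    1#                           ≤⟨ 1≤g ⟩
    g₁ (size z)                  ≈⟨ *-identityʳ _ ⟨
    g₁ (size z) * 1#             ≡⟨ ≡.cong (g₁ (size z) *_) D≡1 ⟨
    g₁ (size z) * 𝓓 r (size z)   ∎

  bound-small : ∀ z r → size z ≤ d → 1# ≤ g₁ (size z) → Pr[ S z > r ] ≤ g₁ (size z) * 𝓓 r (size z)
  bound-small z r z≤d 1≤g = cases (r ≤? u d)
    where
    cases : Dec (r ≤ u d) → Pr[ S z > r ] ≤ g₁ (size z) * 𝓓 r (size z)
    cases (yes r≤ud) = certain z r 1≤g (D-base r≤ud)
    cases (no  r≰ud) = begin
      Pr[ S z > r ]                ≤⟨ small z r z≤d (≰⇒> r≰ud) ⟩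
      0#                           ≈⟨ zeroʳ _ ⟨
      g₁ (size z) * 0#             ≡⟨ ≡.cong (g₁ (size z) *_) (D-small (≰⇒> r≰ud) z≤d) ⟨
      g₁ (size z) * 𝓓 r (size z)   ∎

  bound-step : ∀ z r → d < size z → u (size z) < r →
               (∀ y → y ∈Support h z → ∀ i r → 1# ≤ g₁ (size (lookup y i)) →
                 Pr[ S (lookup y i) > r ] ≤ g₁ (size (lookup y i)) * 𝓓 r (size (lookup y i))) →
               Pr[ S z > r ] ≤ g₁ (size z) * 𝓓 r (size z)
  bound-step z r d<z uz<r ih = begin
    Pr[ S z > r ]                              ≤⟨ recurrence z d<z r ⟩
    -- Splitting does not increase sizes, so `maxSize` is bounded on the support and its expectation
    -- is a genuine supremum.
    𝔼[ (λ y → Pr[ maxCopies y > r′ ]) ∘ h z ]  ≤⟨ 𝔼-scaled-mono (h z) 0≤gc (0≤size z)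
      (λ y y∈h → maximum≤ size y (h-shrinks z y y∈h)) max-bound ⟩
    g * c * 𝔼[ maxSize ∘ h z ]                 ≤⟨ *-monoʳ-≤ 0≤gc (𝔼-size z) ⟩
    g * c * m x                                ≈⟨ *-assoc g c (m x) ⟩
    g * (c * m x)                              ≈⟨ *-congˡ c*m≈D ⟩
    g * 𝓓 r x                                  ∎
    where
    x r′ g : ℝ
    x  = size z
    r′ = r - a x
    g  = g₁ x
    open LinearMajorant (linearMajorant d<z (≤-<-trans (u-mono (<⇒≤ d<z)) uz<r) uz<r)
    maxCopies : ∀ y → RealVariable (Coupling.space (copies z y))
    maxCopies y = maxᵛ (Coupling.variables (copies z y))
    0≤gc : 0# ≤ g * c
    0≤gc = *-nonNegative (g₁-nonNegative x) c-nonNegative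
    -- Replacing each part's size by the maximum M gives all terms the common factor c * M; what
    -- remains is the sum of the weights, bounded by the weight of z.
    max-bound : ∀ y → y ∈Support h z → Pr[ maxCopies y > r′ ] ≤ g * c * maxSize y
    max-bound y y∈h = begin
      Pr[ maxCopies y > r′ ]                                   ≤⟨ Pr-maxᵛ
        (λ yᵢ → g₁ (size yᵢ) * (c * M)) y (Coupling.variables (copies z y)) r′ copy-bound ⟩
      sum (Vec.map (λ yᵢ → g₁ (size yᵢ) * (c * M)) y)          ≈⟨ sum-*ʳ (λ yᵢ → g₁ (size yᵢ)) (c * M) y ⟩
      sum (Vec.map (λ yᵢ → g₁ (size yᵢ)) y) * (c * M)          ≤⟨ *-monoˡ-≤ 0≤cM (g₁-splits z d<z y y∈h) ⟩
      g * (c * M)                                              ≈⟨ *-assoc g c M ⟨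
      g * c * M                                                ∎
      where
      M : ℝ
      M = maxSize y
      0≤cM : 0# ≤ c * M
      0≤cM = *-nonNegative c-nonNegative (≤-trans (0≤size (lookup y zero)) (lookup≤maximum size y zero))
      -- For a part of size at most d the weight may be too small for the induction hypothesis, but
      -- its tail beyond r′ is 0.
      part-bound : ∀ i → Dec (size (lookup y i) ≤ d) → Pr[ S (lookup y i) > r′ ] ≤ g₁ (size (lookup y i)) * (c * M)
      part-bound i (yes yᵢ≤d) = ≤-trans (small (lookup y i) r′ yᵢ≤d u[d]<r-a)
        (*-nonNegative (g₁-nonNegative _) 0≤cM)
      part-bound i (no  yᵢ≰d) = begin
        Pr[ S (lookup y i) > r′ ]     ≤⟨ ih y y∈h i r′ (g₁≥1 _ d<yᵢ) ⟩
        g₁ yᵢ * 𝓓 r′ yᵢ               ≤⟨ *-monoʳ-≤ (g₁-nonNegative yᵢ)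
          (≤-trans (D≤c*y yᵢ d<yᵢ (h-shrinks z y y∈h i)) (*-monoʳ-≤ c-nonNegative (lookup≤maximum size y i))) ⟩
        g₁ yᵢ * (c * M)               ∎
        where
        yᵢ : ℝ
        yᵢ = size (lookup y i)
        d<yᵢ : d < yᵢ
        d<yᵢ = ≰⇒> yᵢ≰d
      copy-bound : ∀ i → Pr[ lookup (Coupling.variables (copies z y)) i > r′ ] ≤ g₁ (size (lookup y i)) * (c * M)
      copy-bound i = ≤-trans (≤-reflexive (Coupling.sameLaw (copies z y) i r′))
                             (part-bound i (size (lookup y i) ≤? d))

  -- One depth k serves all words of indices, so every part terminates within one step less. The
  -- threshold is quantified inside the induction because the parts are met with r - a x instead of
  -- r.
  bound : ∀ k z → Terminates k z → ∀ r → 1# ≤ g₁ (size z) → Pr[ S z > r ] ≤ g₁ (size z) * 𝓓 r (size z)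
  bound zero    z terminated r 1≤g = bound-small z r (Pr-nested>≈0-base size h d z (terminated [])) 1≤g
  bound (suc k) z terminated r 1≤g = cases (size z ≤? d) (r ≤? u (size z))
    where
    terminated-part : ∀ y → y ∈Support h z → ∀ i → Terminates k (lookup y i)
    terminated-part y y∈h i is = Pr-nested>≈0-step size h d i is z (terminated (i ∷ is)) y y∈h
    cases : Dec (size z ≤ d) → Dec (r ≤ u (size z)) → Pr[ S z > r ] ≤ g₁ (size z) * 𝓓 r (size z)
    cases (yes z≤d) _          = bound-small z r z≤d 1≤g
    cases (no  z≰d) (yes r≤uz) = certain z r 1≤g (D-certain (≰⇒> z≰d) r≤uz)
    cases (no  z≰d) (no  r≰uz) = bound-step z r (≰⇒> z≰d) (≰⇒> r≰uz)
      (λ y y∈h i → bound k (lookup y i) (terminated-part y y∈h i))
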